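{- For every integer $n\ge 2$, $$\sum_{p\in T_{n,n-1}}\mathbf{x}^{\operatorname{Des}(p)}=\sum_{\pi\in\mathfrak{S}_n^*(321)}\mathbf{x}^{\operatorname{Des}(\pi)},$$ where $\mathbf{x}^J:=\prod_{j\in J}x_j$. Equivalently, $\mathcal{Q}(T_{n,n-1})=\mathcal{Q}(\mathfrak{S}_n^*(321))$.
   Context: $\overrightarrow{K}_n$ is the transitive tournament with vertex set $\{1,\dots,n\}$ and directed edges $(i,j)$, $i<j$. $T_{n,n-1}$ is the set of transitive $(n-1)$-partitions of $\overrightarrow{K}_n$: unordered partitions of the edge set into $n-1$ nonempty blocks such that every cycle of the underlying undirected graph contains two edges in the same block with opposite orientations with respect to a traversal of the cycle. For $p\in T_{n,n-1}$, $\operatorname{Des}(p):=\{i\in\{1,\dots,n-1\}: \text{the edge }(i,i+1)\text{ forms a singleton block in }p\}$. A permutation $\pi\in\mathfrak{S}_n$ is indecomposable if there is no $1\le r<n$ such that $\pi(i)<\pi(j)$ for all $i\le r<j$. $\mathfrak{S}_n^*(321)$ is the set of indecomposable permutations in $\mathfrak{S}_n$ with no decreasing subsequence of length 3. For $\pi\in\mathfrak{S}_n$, $\operatorname{Des}(\pi):=\{i: \pi(i)>\pi(i+1)\}$. For a finite set $A$ with a map $\operatorname{Des}:A\to 2^{\{1,\dots,n-1\}}$, $\mathcal{Q}(A):=\sum_{a\in A}\mathcal{F}_{\operatorname{Des}(a)}$, where $\mathcal{F}_J(\mathbf{x}):=\sum x_{i_1}\cdots x_{i_n}$ over $i_1\le\dots\le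 i_n$ with $i_j<i_{j+1}$ whenever $j\in J$. -}

module Defs where

open import Algebra.Bundles using (CommutativeRing)
open import Data.Bool.Properties as Bool using ()
open import Data.Fin.Base using (Fin; zero; suc; inject₁; _<_; _≤_)
open import Data.Fin.Properties using (_≟_; _<?_; _≤?_; all?; any?; injective⇒≤)
open import Data.Fin.Subset as Subset using (Subset; ⁅_⁆)
open import Data.Fin.Subset.Properties using () renaming (_∈?_ to _∈ˢ?_)
open import Data.List.Base as List
  using (List; []; _∷_; _∷ʳ_; length; map; zip; filter; foldr; allFin;
         concatMap; upTo; deduplicate; cartesianProduct; cartesianProductWith)
open import Data.List.Membership.Propositional using (_∈_; lose)
open import Data.List.Membership.Propositional.Properties
  using (∈-cartesianProductWith⁺; ∈-allFin; ∈-map⁺; ∈-concatMap⁺; ∈-upTo⁺; ∈-lookup)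
import Data.List.Membership.DecPropositional as DecMembership
open import Data.List.Relation.Unary.All as All using (All; []; _∷_)
open import Data.List.Relation.Unary.AllPairs using ([]; _∷_)
open import Data.List.Relation.Unary.Any using (here)
open import Data.List.Relation.Unary.Unique.Propositional using (Unique)
open import Data.List.Relation.Unary.Unique.Propositional.Properties
  using (cartesianProductWith⁺)
import Data.List.Relation.Unary.Unique.DecPropositional as DecUnique
open import Data.Nat.Base as ℕ using (ℕ; zero; suc; _∸_; s≤s)
open import Data.Nat.ListAction using (sum)
import Data.Nat.Properties as ℕ
open import Data.Product.Base using (_×_; _,_; proj₁; proj₂; ∃; ∃₂)
open import Data.Product.Properties using () renaming (≡-dec to ×-≡-dec)
open import Data.Vec.Base as Vec using (Vec; []; _∷_; lookup; tabulate; toList)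
open import Data.Vec.Properties
  using (∷-injective; toList∘fromList) renaming (≡-dec to Vec-≡-dec)
open import Function.Base using (_∘_)
open import Function.Consequences.Propositional
  using (strictlySurjective⇒surjective; surjective⇒strictlySurjective)
open import Function.Definitions using (Bijective; Injective)
open import Level using (Level)
open import Relation.Binary.Definitions using (DecidableEquality)
open import Relation.Binary.PropositionalEquality
  using (_≡_; refl; sym; cong; subst)
open import Relation.Nullary using (¬_; Dec; does; ¬?; _×-dec_; _→-dec_; contradiction)
open import Relation.Nullary.Decidable using (map′)

private
  variable
    a : Level
    A : Set a

------------------------------------------------------------------------
-- Enumerating vectors

-- All vectors of length k with entries in xs.
vecs : List A → (k : ℕ) → List (Vec A k)
vecs xs zero    = [] ∷ []
vecs xs (suc k) = cartesianProductWith _∷_ xs (vecs xs k)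

vecs-complete : {xs : List A} → (∀ x → x ∈ xs) →
                ∀ {k} (v : Vec A k) → v ∈ vecs xs k
vecs-complete complete []      = here refl
vecs-complete complete (x ∷ v) =
  ∈-cartesianProductWith⁺ _∷_ (complete x) (vecs-complete complete v)

vecs-unique : {xs : List A} → Unique xs → ∀ k → Unique (vecs xs k)
vecs-unique unique zero    = [] ∷ []
vecs-unique unique (suc k) =
  cartesianProductWith⁺ _∷_ ∷-injective unique (vecs-unique unique k)

------------------------------------------------------------------------
-- Indices

-- Throughout, {1,…,n} is Fin n and {1,…,n-1} is Fin (n ∸ 1), both shifted
-- down by one.  For i ∈ {1,…,n-1}, `left i` and `right i` are i and i+1 as
-- elements of {1,…,n}.

left : ∀ {n} → Fin (n ∸ 1) → Fin n
left {suc n} i = inject₁ i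

right : ∀ {n} → Fin (n ∸ 1) → Fin n
right {suc n} i = suc i

toSubset : ∀ {n} {P : Fin n → Set} → (∀ i → Dec (P i)) → Subset n
toSubset P? = tabulate (does ∘ P?)

------------------------------------------------------------------------
-- The transitive tournament and partitions of its edges

_≟ˢ_ : ∀ {n} → DecidableEquality (Subset n)
_≟ˢ_ = Vec-≡-dec Bool._≟_

allSubsets : ∀ m → List (Subset m)
allSubsets = vecs (Subset.outside ∷ Subset.inside ∷ [])

-- The ordered pairs (v₁,v₂), …, (vₖ₋₁,vₖ), (vₖ,v₁).
steps : List A → List (A × A)
steps []       = []
steps (v ∷ vs) = zip (v ∷ vs) (vs ∷ʳ v)

lookup-injective : {xs : List A} → Unique xs → Injective _≡_ _≡_ (List.lookup xs)
lookup-injective (_  ∷ _) {zero}  {zero}  _  = refl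
lookup-injective (x∉ ∷ _) {zero}  {suc j} eq =
  contradiction eq (All.lookup x∉ (∈-lookup j))
lookup-injective (x∉ ∷ _) {suc i} {zero}  eq =
  contradiction (sym eq) (All.lookup x∉ (∈-lookup i))
lookup-injective (_  ∷ u) {suc i} {suc j} eq = cong suc (lookup-injective u eq)

module _ (n : ℕ) where

  edges : List (Fin n × Fin n)
  edges = filter (λ (i , j) → i <? j) (cartesianProduct (allFin n) (allFin n))

  #edges : ℕ
  #edges = length edges

  Edge : Set
  Edge = Fin #edges

  endpoints : Edge → Fin n × Fin n
  endpoints = List.lookup edges

  -- A partition p of the edge set is stored by listing, for each edge e, the
  -- block `lookup p e` containing e; blocks are sets, so each unordered
  -- partition is represented exactly once, and its blocks are nonempty.
  BlockMap : Set
  BlockMap = Vec (Subset #edges) #edges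

  IsPartition : BlockMap → Set
  IsPartition p = (∀ e → e Subset.∈ lookup p e)
                × (∀ e f → f Subset.∈ lookup p e → lookup p f ≡ lookup p e)

  blocks : BlockMap → List (Subset #edges)
  blocks p = deduplicate _≟ˢ_ (toList p)

  -- A cycle of the complete graph on Fin n, with a traversal: its vertices in
  -- the order in which they are visited.
  IsCycle : List (Fin n) → Set
  IsCycle vs = 3 ℕ.≤ length vs × Unique vs

  Along Against : Edge → List (Fin n) → Set
  Along   e vs = endpoints e ∈ steps vs
  Against e vs = (proj₂ (endpoints e) , proj₁ (endpoints e)) ∈ steps vs

  HasOppositePair : BlockMap → List (Fin n) → Set
  HasOppositePair p vs =
    ∃₂ λ e f → f Subset.∈ lookup p e × Along e vs × Against f vs

  IsTransitive : BlockMap → Set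
  IsTransitive p = ∀ vs → IsCycle vs → HasOppositePair p vs

  InT : ℕ → BlockMap → Set
  InT r p = IsPartition p × length (blocks p) ≡ r × IsTransitive p

  -- Cycles have length at most n, so finitely many lists need inspection.
  shortLists : List (List (Fin n))
  shortLists = concatMap (λ k → map toList (vecs (allFin n) k)) (upTo (suc n))

  cycle∈shortLists : (vs : List (Fin n)) → IsCycle vs → vs ∈ shortLists
  cycle∈shortLists vs (_ , unique) =
    ∈-concatMap⁺ (λ k → map toList (vecs (allFin n) k))
      (lose (∈-upTo⁺ (s≤s (injective⇒≤ (lookup-injective unique))))
        (subst (_∈ map toList (vecs (allFin n) (length vs)))
          (toList∘fromList vs)
          (∈-map⁺ toList (vecs-complete ∈-allFin (Vec.fromList vs)))))

  isPartition? : (p : BlockMap) → Dec (IsPartition p)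
  isPartition? p =
    all? (λ e → e ∈ˢ? lookup p e) ×-dec
    all? (λ e → all? λ f → (f ∈ˢ? lookup p e) →-dec (lookup p f ≟ˢ lookup p e))

  isCycle? : (vs : List (Fin n)) → Dec (IsCycle vs)
  isCycle? vs = (3 ℕ.≤? length vs) ×-dec DecUnique.unique? _≟_ vs

  hasOppositePair? : (p : BlockMap) → ∀ vs → Dec (HasOppositePair p vs)
  hasOppositePair? p vs = any? λ e → any? λ f →
    (f ∈ˢ? lookup p e) ×-dec (_ ∈? steps vs) ×-dec (_ ∈? steps vs)
    where open DecMembership (×-≡-dec _≟_ _≟_) using (_∈?_)

  isTransitive? : (p : BlockMap) → Dec (IsTransitive p)
  isTransitive? p = map′
    (λ all vs c → All.lookup all (cycle∈shortLists vs c) c)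
    (λ trans → All.universal trans shortLists)
    (All.all? (λ vs → isCycle? vs →-dec hasOppositePair? p vs) shortLists)

  inT? : ∀ r (p : BlockMap) → Dec (InT r p)
  inT? r p = isPartition? p ×-dec (length (blocks p) ℕ.≟ r) ×-dec isTransitive? p

  -- Each transitive r-partition occurs exactly once.
  T : ℕ → List BlockMap
  T r = filter (inT? r) (vecs (allSubsets #edges) #edges)

  SingletonAt : BlockMap → Fin (n ∸ 1) → Set
  SingletonAt p i = ∃ λ e → endpoints e ≡ (left i , right i) × ⁅ e ⁆ ∈ blocks p

  singletonAt? : (p : BlockMap) → ∀ i → Dec (SingletonAt p i)
  singletonAt? p i = any? λ e →
    ×-≡-dec _≟_ _≟_ (endpoints e) (left i , right i) ×-dec (⁅ e ⁆ ∈? blocks p)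
    where open DecMembership _≟ˢ_ using (_∈?_)

  DesT : BlockMap → Subset (n ∸ 1)
  DesT p = toSubset (singletonAt? p)

------------------------------------------------------------------------
-- Permutations, in one-line notation

Word : ℕ → Set
Word n = Vec (Fin n) n

IsPermutation : ∀ {n} → Word n → Set
IsPermutation π = Bijective _≡_ _≡_ (lookup π)

Decomposes : ∀ {n} → Word n → Fin (n ∸ 1) → Set
Decomposes {n} π r = ∀ (i j : Fin n) → i ≤ left {n} r → left {n} r < j → lookup π i < lookup π j

Indecomposable : ∀ {n} → Word n → Set
Indecomposable π = ¬ ∃ (Decomposes π)

Avoids321 : ∀ {n} → Word n → Set
Avoids321 π = ¬ ∃ λ i → ∃ λ j → ∃ λ k →
  i < j × j < k × lookup π j < lookup π i × lookup π k < lookup π j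

InS*321 : ∀ n → Word n → Set
InS*321 n π = IsPermutation π × Indecomposable π × Avoids321 π

isPermutation? : ∀ {n} (π : Word n) → Dec (IsPermutation π)
isPermutation? {n} π =
  map′ (λ inj {i} {j} → inj i j) (λ inj i j → inj {i} {j})
    (all? λ i → all? λ j → (lookup π i ≟ lookup π j) →-dec (i ≟ j))
  ×-dec
  map′ strictlySurjective⇒surjective surjective⇒strictlySurjective
    (all? λ y → any? λ i → lookup π i ≟ y)

indecomposable? : ∀ {n} (π : Word n) → Dec (Indecomposable π)
indecomposable? {n} π = ¬? (any? λ r → all? λ i → all? λ j →
  (i ≤? left {n} r) →-dec (left {n} r <? j) →-dec (lookup π i <? lookup π j))

avoids321? : ∀ {n} (π : Word n) → Dec (Avoids321 π)
avoids321? π = ¬? (any? λ i → any? λ j → any? λ k →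
  (i <? j) ×-dec (j <? k) ×-dec
  (lookup π j <? lookup π i) ×-dec (lookup π k <? lookup π j))

inS*321? : ∀ n (π : Word n) → Dec (InS*321 n π)
inS*321? n π = isPermutation? π ×-dec indecomposable? π ×-dec avoids321? π

-- Each permutation in the class occurs exactly once.
S*321 : ∀ n → List (Word n)
S*321 n = filter (inS*321? n) (vecs (allFin n) n)

DesS : ∀ {n} → Word n → Subset (n ∸ 1)
DesS π = toSubset λ i → lookup π (right i) <? lookup π (left i)

------------------------------------------------------------------------
-- Σ_{a ∈ A} x^{D a} for x₁,…,xₘ in a commutative ring.  A polynomial
-- identity over ℤ is such an identity for all commutative rings and all x.

module _ {c ℓ} (R : CommutativeRing c ℓ) where
  open CommutativeRing R

  ∑ : List A → (A → Carrier) → Carrier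
  ∑ as f = foldr _+_ 0# (map f as)

  ∏ : List A → (A → Carrier) → Carrier
  ∏ as f = foldr _*_ 1# (map f as)

  monomial : ∀ {m} → (Fin m → Carrier) → Subset m → Carrier
  monomial {m} x J = ∏ (filter (_∈ˢ? J) (allFin m)) x

------------------------------------------------------------------------
-- Quasisymmetric functions, as formal power series in x₁, x₂, …

-- The series Φ has coefficient Φ α at the monomial x₁^α₁ ⋯ x_N^α_N.
Series : Set
Series = ∀ {N} → Vec ℕ N → ℕ

_≋_ : Series → Series → Set
Φ ≋ Ψ = ∀ {N} (α : Vec ℕ N) → Φ α ≡ Ψ α

-- x_{i₁} ⋯ x_{iₙ} = x₁^α₁ ⋯ x_N^α_N  where  α = exponents i.
exponents : ∀ {N n} → Vec (Fin N) n → Vec ℕ N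
exponents i = tabulate λ v → Vec.count (v ≟_) i

Admissible : ∀ {N n} → Subset (n ∸ 1) → Vec (Fin N) n → Set
Admissible J i =
    (∀ j → lookup i (left j) ≤ lookup i (right j))
  × (∀ j → j Subset.∈ J → lookup i (left j) < lookup i (right j))

admissible? : ∀ {N n} (J : Subset (n ∸ 1)) (i : Vec (Fin N) n) → Dec (Admissible J i)
admissible? J i =
  all? (λ j → lookup i (left j) ≤? lookup i (right j)) ×-dec
  all? (λ j → (j ∈ˢ? J) →-dec (lookup i (left j) <? lookup i (right j)))

-- The coefficient at α counts the admissible index sequences whose product
-- x_{i₁} ⋯ x_{iₙ} is x^α; these only involve the variables x₁,…,x_N.
F : ∀ n → Subset (n ∸ 1) → Series
F n J {N} α = length
  (filter (λ i → admissible? J i ×-dec Vec-≡-dec ℕ._≟_ (exponents i) α)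
          (vecs (allFin N) n))

Q : ∀ {A : Set} n → List A → (A → Subset (n ∸ 1)) → Series
Q n as Des α = sum (map (λ a → F n (Des a) α) as)

{-# OPTIONS --safe #-}
module Submission where

-- Both sides are parametrised by the preorder degree sequences of plane trees
-- with n nodes (Łukasiewicz words).
--
-- A partition is transitive as soon as every triangle i < j < k has (i,k) in the
-- block of (i,j) or of (j,k).  Hence each block contains an edge (i,i+1), so
-- having n-1 blocks means that these edges lie in distinct blocks, and mapping an
-- edge to the i with (i,i+1) in its block is a colouring c with c(i,i+1) = i and
-- c(i,k) ∈ {c(i,j), c(j,k)}.  Such a colouring on the vertices i, i+1, … extends
-- the one on i+1, … by a single choice: the number of trees of the forest built so
-- far that become the subtrees of the new node i.
--
-- On the other side, the Lehmer code of an indecomposable 321-avoiding permutation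
-- is read from left to right while the number s of unused values below the
-- current maximum is recorded: the next value is either the smallest unused one,
-- and s drops by one, or a new maximum, and s does not decrease.
--
-- In both cases i is a descent exactly when node i has a child and node i+1 of the
-- preorder has none.

open import Defs
open import Algebra.Bundles using (CommutativeRing)
open import Data.Fin.Base as Fin using (Fin; zero; suc; toℕ; fromℕ<; inject₁; punchIn; punchOut)
import Data.Fin.Properties as Fin
open import Data.Fin.Subset as Subset using (Subset; ⁅_⁆; inside; outside)
import Data.Fin.Subset.Properties as Subset
open import Data.List.Base as List
  using (List; []; _∷_; _∷ʳ_; length; map; foldr; zip; allFin; cartesianProduct)
open import Data.List.Membership.Propositional using (_∈_; _∉_)
open import Data.List.Membership.Propositional.Properties as List
  using (∈-filter⁺; ∈-filter⁻; ∈-cartesianProduct⁺; ∈-allFin; ∈-map⁺; ∈-map⁻;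
         ∈-deduplicate⁺; ∈-deduplicate⁻)
open import Data.List.Membership.Propositional.Properties.WithK using (unique∧set⇒bag)
open import Data.List.Properties using (length-map; length-tabulate; map-∘; map-cong)
open import Data.List.Relation.Binary.BagAndSetEquality using (∼bag⇒↭)
open import Data.List.Relation.Binary.Permutation.Propositional
  using (_↭_; ↭-trans; ↭-reflexive; ↭⇒↭ₛ′)
open import Data.List.Relation.Binary.Permutation.Propositional.Properties
  using (↭-length) renaming (map⁺ to ↭-map⁺)
open import Data.List.Relation.Binary.Permutation.Setoid.Properties using (foldr-commMonoid)
open import Data.List.Relation.Unary.All as All using (All; []; _∷_)
open import Data.List.Relation.Unary.AllPairs using ([]; _∷_)
open import Data.List.Relation.Unary.Any as Any using (here; there)
import Data.List.Relation.Unary.Any.Properties as Any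
open import Data.List.Relation.Unary.Unique.Propositional using (Unique)
import Data.List.Relation.Unary.Unique.Propositional.Properties as Unique
import Data.List.Relation.Unary.Unique.DecPropositional.Properties as DecUnique
open import Data.Nat.Base
open import Data.Nat.ListAction using (sum)
open import Data.Nat.ListAction.Properties using (sum-↭)
open import Data.Nat.Properties as ℕ using (_≤?_)
open import Data.Product using (_×_; _,_; proj₁; proj₂; ∃; ∃₂; swap)
open import Data.Product.Properties using (,-injective)
open import Data.Sum.Base as Sum using (_⊎_; inj₁; inj₂)
open import Data.Vec.Base using (Vec; lookup; tabulate; toList)
import Data.Vec.Membership.Propositional.Properties as Vec
import Data.Vec.Properties as Vec
import Data.Vec.Relation.Unary.Any as VecAny
import Data.Vec.Relation.Unary.Any.Properties as VecAny
open import Function.Base using (_∘_)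
open import Function.Bundles using (_⇔_; mk⇔; Equivalence)
open import Function.Consequences.Propositional using (strictlySurjective⇒surjective)
open import Function.Construct.Composition using (_⇔-∘_)
open import Function.Construct.Symmetry using (⇔-sym)
open import Function.Definitions using (Injective)
open import Level using (Level)
open import Relation.Binary.Definitions using (tri<; tri≈; tri>)
open import Relation.Binary.PropositionalEquality hiding (setoid; isEquivalence)
open import Relation.Nullary
open import Relation.Nullary.Decidable using (decidable-stable; dec-true; does-⇔)

private
  variable
    d s t m n : ℕ

-- Plane forests as degree sequences.

-- Path s m: the preorder degree sequences of plane forests with s trees and m
-- nodes, step d being a root with d children.
data Path : ℕ → ℕ → Set where
  stop : Path 0 0
  step : ∀ d → Path (d + s) m → Path (suc s) (suc m)

degree : Path s m → ℕ → ℕ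
degree stop       _       = 0
degree (step d p) zero    = d
degree (step d p) (suc i) = degree p i

IsPeak : Path s m → ℕ → Set
IsPeak p i = 0 < degree p i × degree p (suc i) ≡ 0

state≤length : Path s m → s ≤ m
state≤length stop               = z≤n
state≤length (step {s = s} d p) = s≤s (ℕ.≤-trans (ℕ.m≤n+m s d) (state≤length p))

-- Indecomposable 321-avoiding permutations

injective⇒surjective : {f : Fin n → Fin n} → Injective _≡_ _≡_ f → ∀ y → ∃ λ i → f i ≡ y
injective⇒surjective {suc n} {f} inj y with Fin.any? (λ i → f i Fin.≟ y)
... | yes hit  = hit
... | no  miss = contradiction (Fin.injective⇒≤ {f = g} g-injective) ℕ.1+n≰n
  where
  y≢f : ∀ i → y ≢ f i
  y≢f i eq = miss (i , sym eq)
  g : Fin (suc n) → Fin n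
  g i = punchOut (y≢f i)
  g-injective : Injective _≡_ _≡_ g
  g-injective {i} {j} eq = inj (Fin.punchOut-injective (y≢f i) (y≢f j) eq)

punchIn-mono-< : ∀ (a : Fin (suc n)) {x y} → x Fin.< y → punchIn a x Fin.< punchIn a y
punchIn-mono-< a {x} {y} x<y = ℕ.≰⇒> (ℕ.<⇒≱ x<y ∘ Fin.punchIn-cancel-≤ a y x)

punchIn-cancel-< : ∀ (a : Fin (suc n)) {x y} → punchIn a x Fin.< punchIn a y → x Fin.< y
punchIn-cancel-< a {x} {y} lt = ℕ.≰⇒> (ℕ.<⇒≱ lt ∘ Fin.punchIn-mono-≤ a y x)

toℕ-punchIn-< : ∀ (a : Fin (suc n)) {x} → toℕ x < toℕ a → toℕ (punchIn a x) ≡ toℕ x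
toℕ-punchIn-< (suc a) {zero}  _         = refl
toℕ-punchIn-< (suc a) {suc x} (s≤s x<a) = cong suc (toℕ-punchIn-< a x<a)

toℕ-punchIn-≥ : ∀ (a : Fin (suc n)) {x} → toℕ a ≤ toℕ x → toℕ (punchIn a x) ≡ suc (toℕ x)
toℕ-punchIn-≥ zero            _         = refl
toℕ-punchIn-≥ (suc a) {suc x} (s≤s a≤x) = cong suc (toℕ-punchIn-≥ a a≤x)

punchIn<⇒< : ∀ (a : Fin (suc n)) {x} → punchIn a x Fin.< a → toℕ x < toℕ a
punchIn<⇒< a {x} lt with toℕ x ℕ.<? toℕ a
... | yes x<a = x<a
... | no  x≮a = contradiction (subst (_< toℕ a) (toℕ-punchIn-≥ a (ℕ.≮⇒≥ x≮a)) lt)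
                              (x≮a ∘ ℕ.<-trans (ℕ.n<1+n _))

<⇒punchIn< : ∀ (a : Fin (suc n)) {x} → toℕ x < toℕ a → punchIn a x Fin.< a
<⇒punchIn< a x<a = subst (_< toℕ a) (sym (toℕ-punchIn-< a x<a)) x<a

≤-punchIn : ∀ (a : Fin (suc n)) x → toℕ x ≤ toℕ (punchIn a x)
≤-punchIn a x with toℕ x ℕ.<? toℕ a
... | yes x<a = ℕ.≤-reflexive (sym (toℕ-punchIn-< a x<a))
... | no  x≮a = subst (toℕ x ≤_) (sym (toℕ-punchIn-≥ a (ℕ.≮⇒≥ x≮a))) (ℕ.n≤1+n _)

punchIn-≤suc : ∀ (a : Fin (suc n)) x → toℕ (punchIn a x) ≤ suc (toℕ x)
punchIn-≤suc a x with toℕ x ℕ.<? toℕ a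
... | yes x<a = subst (_≤ suc (toℕ x)) (sym (toℕ-punchIn-< a x<a)) (ℕ.n≤1+n _)
... | no  x≮a = ℕ.≤-reflexive (toℕ-punchIn-≥ a (ℕ.≮⇒≥ x≮a))

-- The inverse of deleting the first letter and standardising: `a` comes first, and the values of
-- `f` from `a` on are raised by one.
insert : Fin (suc n) → (Fin n → Fin n) → Fin (suc n) → Fin (suc n)
insert a f zero    = a
insert a f (suc i) = punchIn a (f i)

-- What remains of an indecomposable 321-avoiding permutation once a prefix has
-- been read off and the remaining values have been standardised to f: the s
-- smallest remaining values are those below the maximum of the prefix.
record Good {m} (s : ℕ) (f : Fin m → Fin m) : Set where
  field
    fits       : s ≤ m
    injective  : Injective _≡_ _≡_ f
    avoids     : ∀ {i j k} → i Fin.< j → j Fin.< k → f j Fin.< f i → ¬ f k Fin.< f j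
    increasing : ∀ {i j} → i Fin.< j → f j Fin.< f i → s ≤ toℕ (f i)
    connected  : ∀ {r} → s ≤ r → r < m → ¬ (∀ i → toℕ i < r → toℕ (f i) < r)

open Good

Good-resp-≗ : {f g : Fin m → Fin m} → f ≗ g → Good s f → Good s g
Good-resp-≗ {f = f} {g} f≗g good = record
  { fits       = fits good
  ; injective  = λ {i} {j} eq → injective good (trans (f≗g i) (trans eq (sym (f≗g j))))
  ; avoids     = λ i<j j<k p q → avoids good i<j j<k (back p) (back q)
  ; increasing = λ {i} i<j p → subst (_ ≤_) (cong toℕ (f≗g i)) (increasing good i<j (back p))
  ; connected  = λ s≤r r<m closed → connected good s≤r r<m
      λ i i<r → subst (_< _) (cong toℕ (sym (f≗g i))) (closed i i<r)
  }
  where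
  back : ∀ {i j} → g i Fin.< g j → f i Fin.< f j
  back {i} {j} = subst₂ Fin._<_ (sym (f≗g i)) (sym (f≗g j))

insert-injective : ∀ {a} {f : Fin m → Fin m} → Injective _≡_ _≡_ f → Injective _≡_ _≡_ (insert a f)
insert-injective         inj {zero}  {zero}  _  = refl
insert-injective {a = a} inj {zero}  {suc j} eq = contradiction (sym eq) (Fin.punchInᵢ≢i a _)
insert-injective {a = a} inj {suc i} {zero}  eq = contradiction eq (Fin.punchInᵢ≢i a _)
insert-injective {a = a} inj {suc i} {suc j} eq = cong suc (inj (Fin.punchIn-injective a _ _ eq))

module _ {a : Fin (suc m)} {f : Fin m → Fin m} (good : Good s (insert a f)) where

  insert-injective⁻ : Injective _≡_ _≡_ f
  insert-injective⁻ eq = Fin.suc-injective (injective good (cong (punchIn a) eq))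

  insert-avoids⁻ : ∀ {i j k} → i Fin.< j → j Fin.< k → f j Fin.< f i → ¬ f k Fin.< f j
  insert-avoids⁻ i<j j<k p q =
    avoids good (s≤s i<j) (s≤s j<k) (punchIn-mono-< a p) (punchIn-mono-< a q)

-- The smallest remaining value lies below the prefix maximum, so reading it uses up one of the
-- `suc s` small values and leaves the maximum in place. Being smallest, it is never the top of an
-- inversion.
insert-0-good : {f : Fin m → Fin m} → Good s f → Good (suc s) (insert zero f)
insert-0-good good .fits      = s≤s (fits good)
insert-0-good good .injective = insert-injective (injective good)
insert-0-good good .avoids {zero} _ _ ()
insert-0-good good .avoids {suc i} {suc j} {suc k} (s≤s i<j) (s≤s j<k) (s≤s p) (s≤s q) =
  avoids good i<j j<k p q
insert-0-good good .increasing {zero} _ ()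
insert-0-good good .increasing {suc i} {suc j} (s≤s i<j) (s≤s p) = s≤s (increasing good i<j p)
insert-0-good good .connected (s≤s s≤r) (s≤s r<m) closed =
  connected good s≤r r<m λ i i<r → s≤s⁻¹ (closed (suc i) (s≤s i<r))

insert-0-good⁻ : {f : Fin m → Fin m} → Good (suc s) (insert zero f) → Good s f
insert-0-good⁻ good = record
  { fits       = s≤s⁻¹ (fits good)
  ; injective  = insert-injective⁻ good
  ; avoids     = insert-avoids⁻ good
  ; increasing = λ i<j p → s≤s⁻¹ (increasing good (s≤s i<j) (s≤s p))
  ; connected  = λ s≤r r<m closed → connected good (s≤s s≤r) (s≤s r<m)
      λ { zero _ → s≤s z≤n ; (suc i) (s≤s i<r) → s≤s (closed i i<r) }
  }

-- Here `a` is a new maximum, and exactly `toℕ a` remaining values lie below it. A 321 starting at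
-- `a` would need an inversion whose top is below `a`, which `increasing` for the state `toℕ a`
-- forbids. A closed prefix contains `a`, and removing `a` leaves a closed prefix of `f`.
insert-good : ∀ {a} {f : Fin m → Fin m} → suc s ≤ toℕ a → Good (toℕ a) f → Good (suc s) (insert a f)
insert-good {a = a} s<a good .fits      = ℕ.<⇒≤ (ℕ.≤-<-trans s<a (Fin.toℕ<n a))
insert-good         s<a good .injective = insert-injective (injective good)
insert-good {a = a} s<a good .avoids {zero} {suc j} {suc k} _ (s≤s j<k) p q =
  ℕ.<⇒≱ (punchIn<⇒< a p) (increasing good j<k (punchIn-cancel-< a q))
insert-good {a = a} s<a good .avoids {suc i} {suc j} {suc k} (s≤s i<j) (s≤s j<k) p q =
  avoids good i<j j<k (punchIn-cancel-< a p) (punchIn-cancel-< a q)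
insert-good         s<a good .increasing {zero} _ _ = s<a
insert-good {a = a} {f} s<a good .increasing {suc i} {suc j} (s≤s i<j) p =
  ℕ.≤-trans s<a (ℕ.≤-trans (increasing good i<j (punchIn-cancel-< a p)) (≤-punchIn a (f i)))
insert-good {a = a} {f} s<a good .connected {suc r} s≤r (s≤s r<m) closed =
  connected good a≤r r<m λ i i<r → below (f i) (closed (suc i) (s≤s i<r))
  where
  a≤r : toℕ a ≤ r
  a≤r = s≤s⁻¹ (closed zero (s≤s z≤n))
  below : ∀ x → toℕ (punchIn a x) < suc r → toℕ x < r
  below x lt with toℕ x ℕ.<? toℕ a
  ... | yes x<a = ℕ.<-≤-trans x<a a≤r
  ... | no  x≮a = s≤s⁻¹ (subst (_< suc r) (toℕ-punchIn-≥ a (ℕ.≮⇒≥ x≮a)) lt)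

insert-good⁻ : ∀ {a} {f : Fin m → Fin m} → s ≤ toℕ a → Good s (insert a f) → Good (toℕ a) f
insert-good⁻ {a = a} {f} s≤a good = record
  { fits       = s≤s⁻¹ (Fin.toℕ<n a)
  ; injective  = insert-injective⁻ good
  ; avoids     = insert-avoids⁻ good
  -- An inversion of `f` with its top below `a` would form a 321 together with `a`.
  ; increasing = λ {i} {j} i<j p → ℕ.≮⇒≥ λ fi<a →
      avoids good {zero} {suc i} {suc j} (s≤s z≤n) (s≤s i<j) (<⇒punchIn< a fi<a) (punchIn-mono-< a p)
  ; connected  = λ {r} a≤r r<m closed → connected good (ℕ.m≤n⇒m≤1+n (ℕ.≤-trans s≤a a≤r)) (s≤s r<m)
      λ { zero    _         → s≤s a≤r
        ; (suc i) (s≤s i<r) → s≤s (ℕ.≤-trans (punchIn-≤suc a (f i)) (closed i i<r)) }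
  }

-- The number of later smaller values: none if the value read is the smallest
-- remaining one; a new maximum is followed by d + s smaller ones.
code : ∀ d → Path (d + s) m → Fin (suc m)
code zero    p = zero
code (suc d) p = fromℕ< (s≤s (state≤length p))

toℕ-code-suc : ∀ d (p : Path (suc d + s) m) → toℕ (code (suc d) p) ≡ suc d + s
toℕ-code-suc d p = Fin.toℕ-fromℕ< (s≤s (state≤length p))

code-injective : ∀ d d′ {p : Path (d + s) m} {p′ : Path (d′ + s) m} →
                 code d p ≡ code d′ p′ → d ≡ d′
code-injective zero    zero    eq = refl
code-injective zero    (suc d′) {p′ = p′} eq with () ← trans (cong toℕ eq) (toℕ-code-suc d′ p′)
code-injective (suc d) zero {p} eq with () ← trans (cong toℕ (sym eq)) (toℕ-code-suc d p)
code-injective {s} (suc d) (suc d′) {p} {p′} eq =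
  ℕ.+-cancelʳ-≡ s _ _ (trans (sym (toℕ-code-suc d p)) (trans (cong toℕ eq) (toℕ-code-suc d′ p′)))

perm : Path s m → Fin m → Fin m
perm stop       = λ ()
perm (step d p) = insert (code d p) (perm p)

perm-good : (p : Path s m) → Good s (perm p)
perm-good stop = record
  { fits = z≤n ; injective = λ { {()} } ; avoids = λ { {()} } ; increasing = λ { {()} }
  ; connected = λ _ () }
perm-good (step zero    p) = insert-0-good (perm-good p)
perm-good (step {s = s} (suc d) p) = insert-good
  (subst (suc s ≤_) (sym (toℕ-code-suc d p)) (s≤s (ℕ.m≤n+m s d)))
  (subst (λ a → Good a (perm p)) (sym (toℕ-code-suc d p)) (perm-good p))

perm-injective : {p q : Path s m} → perm p ≗ perm q → p ≡ q
perm-injective {p = stop}     {stop}      _  = refl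
perm-injective {p = step d p} {step d′ q} eq with refl ← code-injective d d′ {p} {q} (eq zero) =
  cong (step d) (perm-injective λ i → Fin.punchIn-injective (code d p) _ _
    (trans (eq (suc i)) (cong (λ a → punchIn a (perm q i)) (sym (eq zero)))))

insert-≗ : ∀ {a b} {f g : Fin m → Fin m} → a ≡ b → f ≗ g → insert a f ≗ insert b g
insert-≗         a≡b f≗g zero    = a≡b
insert-≗ {a = a} a≡b f≗g (suc i) = cong₂ punchIn a≡b (f≗g i)

-- The first value determines the step: 0 gives a leaf, and a positive value is a new maximum whose
-- size gives the degree.
perm-surjective : (f : Fin m → Fin m) → Good s f → ∃ λ (p : Path s m) → perm p ≗ f
perm-surjective {zero}  {zero}  f good = stop , λ ()
perm-surjective {zero}  {suc s} f good with () ← fits good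
-- In state 0 the values read so far form a closed prefix. As values remain, this contradicts
-- `connected` at `r = 0`, where closedness is vacuous.
perm-surjective {suc m} {zero}  f good = contradiction (λ _ ()) (connected good z≤n (s≤s z≤n))
perm-surjective {suc m} {suc s} f good = extend (f zero) refl good′
  where
  f₀≢ : ∀ i → f zero ≢ f (suc i)
  f₀≢ i eq with () ← injective good eq
  g : Fin m → Fin m
  g i = punchOut (f₀≢ i)
  f≗ : f ≗ insert (f zero) g
  f≗ zero    = refl
  f≗ (suc i) = sym (Fin.punchIn-punchOut (f₀≢ i))
  good′ : Good (suc s) (insert (f zero) g)
  good′ = Good-resp-≗ f≗ good
  extend : ∀ a → f zero ≡ a → Good (suc s) (insert a g) → ∃ λ (p : Path (suc s) (suc m)) → perm p ≗ f
  extend zero f₀≡ h = step 0 p , λ i →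
    trans (insert-≗ (sym f₀≡) perm≗ i) (sym (f≗ i))
    where
    tail = perm-surjective g (insert-0-good⁻ h)
    p = proj₁ tail
    perm≗ = proj₂ tail
  extend (suc b) f₀≡ h = step (suc k) p , λ i →
    trans (insert-≗ (trans code≡ (sym f₀≡)) perm≗ i) (sym (f≗ i))
    where
    -- The value 0 occurs after the positive first value, so the two form an inversion; `increasing`
    -- then puts the first value above the small ones.
    hit = injective⇒surjective (injective h) zero
    s<a : suc s ≤ suc (toℕ b)
    s<a with hit
    ... | suc j , eq = increasing h {zero} {suc j} (s≤s z≤n) (subst (Fin._< suc b) (sym eq) (s≤s z≤n))
    -- Chosen so that the new state `suc k + s` equals the first value `suc b`.
    k = toℕ b ∸ s
    a≡ : suc (toℕ b) ≡ suc k + s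
    a≡ = cong suc (sym (ℕ.m∸n+n≡m (s≤s⁻¹ s<a)))
    tail = perm-surjective g (subst (λ a → Good a g) a≡ (insert-good⁻ {a = suc b} s<a h))
    p = proj₁ tail
    perm≗ = proj₂ tail
    code≡ : code (suc k) p ≡ suc b
    code≡ = Fin.toℕ-injective (trans (toℕ-code-suc k p) (sym a≡))

-- Only two successive steps matter. A leaf reads the smallest remaining value, so no descent starts
-- there, and one ends there if the step before read a new maximum. Two successive new maxima
-- ascend.
perm-descent : ∀ (p : Path s (suc m)) (i : Fin m) →
               perm p (suc i) Fin.< perm p (inject₁ i) ⇔ IsPeak p (toℕ i)
perm-descent (step zero p) zero = mk⇔ (λ ()) (λ { (() , _) })
perm-descent (step (suc d) q@(step zero p)) zero = mk⇔
  (λ _ → s≤s z≤n , refl)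
  (λ _ → <⇒punchIn< (code (suc d) q) (subst (0 <_) (sym (toℕ-code-suc d q)) (s≤s z≤n)))
perm-descent {suc s} (step (suc d) q@(step (suc d′) p)) zero = mk⇔
  (λ lt → contradiction
    (subst₂ _<_ (toℕ-code-suc d′ p) (toℕ-code-suc d q) (punchIn<⇒< (code (suc d) q) lt))
    (ℕ.≤⇒≯ (s≤s (ℕ.m≤n+m (d + s) d′))))
  (λ { (_ , ()) })
perm-descent (step d p) (suc i) = mk⇔
  (Equivalence.to (perm-descent p i) ∘ punchIn-cancel-< (code d p))
  (punchIn-mono-< (code d p) ∘ Equivalence.from (perm-descent p i))

-- Colourings

-- A transitive (n-1)-partition as a map c of edges to colours, where the
-- colour of an edge is the unique i such that (i, i+1) lies in its block.
record IsColouring (n : ℕ) (c : ℕ → ℕ → ℕ) : Set where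
  field
    consecutive : ∀ {i} → suc i < n → c i (suc i) ≡ i
    triangle    : ∀ {i j k} → i < j → j < k → k < n → c i k ≡ c i j ⊎ c i k ≡ c j k

  -- Induction on the right end: the triangle with the last edge `(j, j+1)` yields either the colour
  -- of a shorter edge or the colour `j`.
  range : ∀ {i j} → i < j → j < n → i ≤ c i j × c i j < j
  range {i} {suc j} (s≤s i≤j) j<n with ℕ.m≤n⇒m<n∨m≡n i≤j
  ... | inj₂ refl = ℕ.≤-reflexive (sym (consecutive j<n)) , s≤s (ℕ.≤-reflexive (consecutive j<n))
  ... | inj₁ i<j with triangle i<j (ℕ.n<1+n j) j<n
  ...   | inj₁ eq = let lo , hi = range i<j (ℕ.<-trans (ℕ.n<1+n j) j<n) in
                    subst (i ≤_) (sym eq) lo , subst (_< suc j) (sym eq) (ℕ.m≤n⇒m≤1+n hi)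
  ...   | inj₂ eq = let eq′ = trans eq (consecutive j<n) in
                    subst (i ≤_) (sym eq′) i≤j , s≤s (ℕ.≤-reflexive eq′)

-- A local test for a singleton class: it inspects only the two edges of length 2 over `(i, i+1)`.
-- Its left half is vacuous for `i = 0`, its right half for the last edge of length 1.
IsIsolated : ℕ → (ℕ → ℕ → ℕ) → ℕ → Set
IsIsolated n c i = (∀ h → i ≡ suc h → c h (suc i) ≡ h) × (suc (suc i) < n → c i (suc (suc i)) ≢ i)

IsSingleton : ℕ → (ℕ → ℕ → ℕ) → ℕ → Set
IsSingleton n c i = ∀ x y → x < y → y < n → c x y ≡ i → x ≡ i × y ≡ suc i

module _ {c : ℕ → ℕ → ℕ} (col : IsColouring n c) where
  open IsColouring col

  -- By `range`, an edge of colour `i` spans `(i, i+1)`. If it is longer, triangles pass its colour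
  -- down to an edge of length 2: colours of edges ending at or before `i` are too small, and those
  -- of edges starting after `i` are too large.
  singleton⇔ : ∀ {i} → suc i < n → IsSingleton n c i ⇔ IsIsolated n c i
  singleton⇔ {i} i+1<n = mk⇔ to from
    where
    to : IsSingleton n c i → IsIsolated n c i
    to single = before , λ lt eq → ℕ.<⇒≢ (ℕ.n<1+n (suc i))
                  (sym (proj₂ (single _ _ (ℕ.m<n⇒m<1+n (ℕ.n<1+n i)) lt eq)))
      where
      before : ∀ h → i ≡ suc h → c h (suc i) ≡ h
      before h refl with triangle (ℕ.n<1+n h) (ℕ.n<1+n (suc h)) i+1<n
      ... | inj₁ eq = trans eq (consecutive (ℕ.<-trans (ℕ.n<1+n i) i+1<n))
      ... | inj₂ eq = contradiction
        (proj₁ (single _ _ (ℕ.m<n⇒m<1+n (ℕ.n<1+n h)) i+1<n (trans eq (consecutive i+1<n))))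
        (ℕ.<⇒≢ (ℕ.n<1+n h))

    from : IsIsolated n c i → IsSingleton n c i
    from (left , right) x y x<y y<n eq = x≡ , y≡
      where
      c-iy : x < i → i < y → c i y ≡ i
      c-iy x<i i<y with triangle x<i i<y y<n
      ... | inj₁ e = contradiction (trans (sym eq) e)
                       (ℕ.<⇒≢ (proj₂ (range x<i (ℕ.<-trans i<y y<n))) ∘ sym)
      ... | inj₂ e = trans (sym e) eq
      far : c i y ≡ i → ¬ suc i < y
      far e i+1<y with ℕ.m≤n⇒m<n∨m≡n i+1<y
      ... | inj₂ refl = right y<n e
      ... | inj₁ i+2<y with triangle (ℕ.m<n⇒m<1+n (ℕ.n<1+n i)) i+2<y y<n
      ...   | inj₁ e′ = right (ℕ.<-trans i+2<y y<n) (trans (sym e′) e)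
      ...   | inj₂ e′ = ℕ.<⇒≱ (ℕ.m<n⇒m<1+n (ℕ.n<1+n i))
                (subst (suc (suc i) ≤_) (trans (sym e′) e) (proj₁ (range i+2<y y<n)))
      x≤i : x ≤ i
      x≤i = subst (x ≤_) eq (proj₁ (range x<y y<n))
      i<y : i < y
      i<y = subst (_< y) eq (proj₂ (range x<y y<n))
      c-iy′ : c i y ≡ i
      c-iy′ with ℕ.m≤n⇒m<n∨m≡n x≤i
      ... | inj₁ x<i  = c-iy x<i i<y
      ... | inj₂ x≡i = trans (cong (λ v → c v y) (sym x≡i)) eq
      y≡ : y ≡ suc i
      y≡ = ℕ.≤-antisym (ℕ.≮⇒≥ (far c-iy′)) i<y
      near : x < i → ∀ h → i ≡ suc h → ¬ c x (suc i) ≡ i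
      near x<i h refl e with ℕ.m≤n⇒m<n∨m≡n (s≤s⁻¹ x<i)
      ... | inj₂ refl = ℕ.<⇒≢ (ℕ.n<1+n h) (trans (sym (left h refl)) e)
      ... | inj₁ x<h with triangle x<h (ℕ.m<n⇒m<1+n (ℕ.n<1+n h)) i+1<n
      ...   | inj₁ e′ =
          ℕ.<⇒≢ (ℕ.m<n⇒m<1+n (proj₂ (range x<h (ℕ.<-trans (ℕ.m<n⇒m<1+n (ℕ.n<1+n h)) i+1<n))))
            (trans (sym e′) e)
      ...   | inj₂ e′ = ℕ.<⇒≢ (ℕ.n<1+n h) (trans (sym (left h refl)) (trans (sym e′) e))
      x≡ : x ≡ i
      x≡ with ℕ.m≤n⇒m<n∨m≡n x≤i
      ... | inj₂ x≡i = x≡i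
      ... | inj₁ x<i = contradiction (trans (cong (c x) (sym y≡)) eq)
                         (near x<i (pred i) (sym (ℕ.suc-pred i {{>-nonZero (ℕ.≤-<-trans z≤n x<i)}})))

-- The colouring of a forest.

-- The number of nodes in the first q trees of the forest.
boundary : Path s m → ℕ → ℕ
boundary stop       _       = 0
boundary (step d p) zero    = 0
boundary (step d p) (suc q) = suc (boundary p (d + q))

boundary-mono-< : ∀ (p : Path s m) {q r} → q < r → r ≤ s → boundary p q < boundary p r
boundary-mono-< stop       (s≤s _) ()
boundary-mono-< (step d p) {zero}  {suc r} q<r       r≤s       = s≤s z≤n
boundary-mono-< (step d p) {suc q} {suc r} (s≤s q<r) (s≤s r≤s) =
  s≤s (boundary-mono-< p (ℕ.+-monoʳ-< d q<r) (ℕ.+-monoʳ-≤ d r≤s))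

boundary-mono-≤ : ∀ (p : Path s m) {q r} → q ≤ r → r ≤ s → boundary p q ≤ boundary p r
boundary-mono-≤ p q≤r r≤s with ℕ.m≤n⇒m<n∨m≡n q≤r
... | inj₁ q<r  = ℕ.<⇒≤ (boundary-mono-< p q<r r≤s)
... | inj₂ refl = ℕ.≤-refl

boundary-cancel-≤ : ∀ (p : Path s m) {q r} → q ≤ s → boundary p q ≤ boundary p r → q ≤ r
boundary-cancel-≤ p q≤s le = ℕ.≮⇒≥ λ r<q → ℕ.<⇒≱ (boundary-mono-< p r<q q≤s) le

boundary-injective : ∀ (p : Path s m) {q r} → q ≤ s → r ≤ s → boundary p q ≡ boundary p r → q ≡ r
boundary-injective p q≤s r≤s eq = ℕ.≤-antisym
  (boundary-cancel-≤ p q≤s (ℕ.≤-reflexive eq))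
  (boundary-cancel-≤ p r≤s (ℕ.≤-reflexive (sym eq)))

boundary-first : (p : Path s m) → boundary p 0 ≡ 0
boundary-first stop       = refl
boundary-first (step d p) = refl

boundary-last : (p : Path s m) → boundary p s ≡ m
boundary-last stop       = refl
boundary-last (step d p) = cong suc (boundary-last p)

-- Vertices and nodes are numbered from 0, with node i standing for the edge
-- (i, i+1).  Node i colours exactly the edges from i into its own subtree; an
-- edge leaving the subtree is coloured as the same edge seen from i+1.
colour : Path s m → ℕ → ℕ → ℕ
colour stop       _       _       = 0
colour (step d p) _       zero    = 0
colour (step d p) (suc i) (suc j) = suc (colour p i j)
colour (step d p) zero    (suc j) with j ≤? boundary p d
... | yes _ = 0
... | no  _ = suc (colour p 0 j)

colour-near : ∀ d (p : Path (d + s) m) {j} → j ≤ boundary p d → colour (step d p) 0 (suc j) ≡ 0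
colour-near d p {j} le with j ≤? boundary p d
... | yes _  = refl
... | no nle = contradiction le nle

colour-far : ∀ d (p : Path (d + s) m) {j} → boundary p d < j →
             colour (step d p) 0 (suc j) ≡ suc (colour p 0 j)
colour-far d p {j} lt with j ≤? boundary p d
... | yes le = contradiction le (ℕ.<⇒≱ lt)
... | no _   = refl

-- Every node from `x` up to the boundary has a subtree that ends before `k`, so the colour is
-- handed on to the root that follows the first `q` trees.
colour-boundary : ∀ (p : Path s m) {x q k} → q ≤ s → x ≤ boundary p q → boundary p q < k →
                  colour p x k ≡ colour p (boundary p q) k
colour-boundary stop _ _ _ = refl
colour-boundary (step d p) {q = zero} _ z≤n _ = refl
colour-boundary (step d p) {suc x} {suc q} (s≤s q≤s) (s≤s x≤b) (s≤s b<k) =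
  cong suc (colour-boundary p (ℕ.+-monoʳ-≤ d q≤s) x≤b b<k)
colour-boundary (step d p) {zero} {suc q} (s≤s q≤s) _ (s≤s b<k) = trans
  (colour-far d p (ℕ.≤-<-trans (boundary-mono-≤ p (ℕ.m≤m+n d q) (ℕ.+-monoʳ-≤ d q≤s)) b<k))
  (cong suc (colour-boundary p (ℕ.+-monoʳ-≤ d q≤s) z≤n b<k))

-- Only triangles at vertex 0 need an argument. If both other vertices are in the range of node 0,
-- both edges have colour 0. If only the farther one is outside, `colour-boundary` equates the two
-- edges ending there. If both are outside, the triangle reduces to the one at vertex 1.
colour-triangle : ∀ (p : Path s m) {i j k} → i < j → j < k → k ≤ m →
                  colour p i k ≡ colour p i j ⊎ colour p i k ≡ colour p j k
colour-triangle (step d p) {suc i} {suc j} {suc k} (s≤s i<j) (s≤s j<k) (s≤s k≤m) =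
  Sum.map (cong suc) (cong suc) (colour-triangle p i<j j<k k≤m)
colour-triangle {m = m} (step d p) {zero} {suc j} {suc k} _ (s≤s j<k) (s≤s k≤m) =
  go j j<k (j ≤? b) (k ≤? b)
  where
  b = boundary p d
  go : ∀ j → j < k → Dec (j ≤ b) → Dec (k ≤ b) →
       colour (step d p) 0 (suc k) ≡ colour (step d p) 0 (suc j) ⊎
       colour (step d p) 0 (suc k) ≡ suc (colour p j k)
  go j j<k (yes j≤b) (yes k≤b) = inj₁ (trans (colour-near d p k≤b) (sym (colour-near d p j≤b)))
  go j j<k (no  j≰b) (yes k≤b) = contradiction (ℕ.≤-trans (ℕ.<⇒≤ j<k) k≤b) j≰b
  go j j<k (yes j≤b) (no  k≰b) = inj₂ (trans (colour-far d p (ℕ.≰⇒> k≰b)) (cong suc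
    (trans (colour-boundary p {q = d} (ℕ.m≤m+n d _) z≤n (ℕ.≰⇒> k≰b))
      (sym (colour-boundary p (ℕ.m≤m+n d _) j≤b (ℕ.≰⇒> k≰b))))))
  go zero    j<k (no j≰b) (no k≰b) = contradiction z≤n j≰b
  go (suc j) j<k (no j≰b) (no k≰b) = Sum.map
    (λ e → trans k-far (trans (cong suc e) (sym (colour-far d p (ℕ.≰⇒> j≰b)))))
    (λ e → trans k-far (cong suc e))
    (colour-triangle p (s≤s z≤n) j<k k≤m)
    where
    k-far = colour-far d p (ℕ.≰⇒> k≰b)

colouring : (p : Path s m) → IsColouring (suc m) (colour p)
colouring p = record
  { consecutive = λ { (s≤s i<m) → consecutive p i<m }
  ; triangle    = λ { i<j j<k (s≤s k≤m) → colour-triangle p i<j j<k k≤m } }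
  where
  consecutive : ∀ (p : Path s m) {i} → i < m → colour p i (suc i) ≡ i
  consecutive (step d p) {zero}  _         = colour-near d p z≤n
  consecutive (step d p) {suc i} (s≤s i<m) = cong suc (consecutive p i<m)

-- Vertex `2 + i` is in the range of node `i` exactly when the subtree of that node has a second
-- node.
colour-peak : ∀ (p : Path s m) {i} → suc i < m → colour p i (2 + i) ≡ i ⇔ 0 < degree p i
colour-peak (step zero p) {zero} _ = mk⇔
  (λ eq → contradiction (trans (sym (colour-far 0 p {1} (s≤s (ℕ.≤-reflexive (boundary-first p))))) eq) λ ())
  (λ ())
colour-peak (step (suc d) p) {zero} _ = mk⇔
  (λ _ → s≤s z≤n)
  (λ _ → colour-near (suc d) p (ℕ.≤-<-trans z≤n (boundary-mono-< p {0} (s≤s z≤n) (s≤s (ℕ.m≤m+n d _)))))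
colour-peak (step d p) {suc i} (s≤s i+1<m) = mk⇔
  (Equivalence.to (colour-peak p i+1<m) ∘ ℕ.suc-injective)
  (cong suc ∘ Equivalence.from (colour-peak p i+1<m))

degree-last : ∀ {i} (p : Path s (suc i)) → degree p i ≡ 0
degree-last {i = zero}  (step d p) = ℕ.n≤0⇒n≡0 (ℕ.m+n≤o⇒m≤o d (state≤length p))
degree-last {i = suc i} (step d p) = degree-last p

-- The added root shifts the nodes by one: the left half of `IsIsolated` concerns node `i` of
-- `step d p`, which is node `i - 1` of `p`, and the right half concerns node `i + 1`. At the two
-- ends, where a half is vacuous, the degree condition is automatic: the root has a child and the
-- last node has none.
singleton⇔peak : ∀ d (p : Path (d + 0) m) {i} → i < m →
                 IsSingleton (suc m) (colour p) i ⇔ IsPeak (step d p) i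
singleton⇔peak {m} d p {i} i<m = mk⇔
  (λ single → let left , right = Equivalence.to single⇔ single in
     parent left , childless right)
  (λ (has-child , no-child) → Equivalence.from single⇔
     ( (λ { h refl → Equivalence.from (colour-peak p i<m) has-child })
     , (λ { (s≤s i+1<m) eq → ℕ.<⇒≢ (Equivalence.to (colour-peak p i+1<m) eq) (sym no-child) })))
  where
  single⇔ = singleton⇔ (colouring p) (s≤s i<m)
  parent : (∀ h → i ≡ suc h → colour p h (suc i) ≡ h) → 0 < degree (step d p) i
  parent = aux i i<m
    where
    positive : ∀ d → Path (d + 0) m → 0 < m → 0 < d
    positive (suc d) _  _ = s≤s z≤n
    positive zero  stop ()
    aux : ∀ i → i < m → (∀ h → i ≡ suc h → colour p h (suc i) ≡ h) → 0 < degree (step d p) i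
    aux zero    0<m _    = positive d p 0<m
    aux (suc h) h<m left = Equivalence.to (colour-peak p h<m) (left h refl)
  childless : (suc (suc i) < suc m → colour p i (suc (suc i)) ≢ i) → degree p i ≡ 0
  childless right with ℕ.m≤n⇒m<n∨m≡n i<m
  ... | inj₂ refl  = degree-last p
  ... | inj₁ i+1<m = ℕ.n≤0⇒n≡0 (ℕ.≮⇒≥ λ pos →
          right (s≤s i+1<m) (Equivalence.from (colour-peak p i+1<m) pos))

-- Every colouring comes from exactly one forest.

_≐[_]_ : (ℕ → ℕ → ℕ) → ℕ → (ℕ → ℕ → ℕ) → Set
c ≐[ n ] c′ = ∀ {i j} → i < j → j < n → c i j ≡ c′ i j

-- Forests are compared together with their number of trees, since a colouring does not display that
-- number. The index equations are arguments so that `refl` can be matched; the degree is recovered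
-- from the end of the subtree by `boundary-injective`.
step-cong : {p : Path s m} {q : Path t m} → _≡_ {A = ∃ λ s → Path s m} (s , p) (t , q) →
            ∀ {d e u v} (s≡ : s ≡ d + u) (t≡ : t ≡ e + v) → boundary p d ≡ boundary q e →
            _≡_ {A = ∃ λ s → Path s (suc m)}
              (suc u , step d (subst (λ s → Path s m) s≡ p))
              (suc v , step e (subst (λ s → Path s m) t≡ q))
step-cong {s} {p = p} refl {d} {e} s≡ t≡ b≡
  with refl ← boundary-injective p (subst (d ≤_) (sym s≡) (ℕ.m≤m+n d _))
                (subst (e ≤_) (sym t≡) (ℕ.m≤m+n e _)) b≡
  with refl ← ℕ.+-cancelˡ-≡ d _ _ (trans (sym s≡) t≡)
  with refl ← s≡ | refl ← t≡ = refl

boundary≤length : ∀ d (p : Path (d + s) m) → boundary p d ≤ m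
boundary≤length {s} d p = subst (boundary p d ≤_) (boundary-last p)
  (boundary-mono-≤ p (ℕ.m≤m+n d s) ℕ.≤-refl)

-- The edges avoiding vertex 0 determine the forest after node 0, and the longest edge of colour 0
-- at vertex 0 marks where the subtree of node 0 ends.
colour-injective : (p : Path s m) (q : Path t m) → colour p ≐[ suc m ] colour q →
                   _≡_ {A = ∃ λ s → Path s m} (s , p) (t , q)
colour-injective stop stop _ = refl
colour-injective {m = suc m} (step {s} d p) (step {t} e q) p≐q =
  step-cong (colour-injective p q λ i<j j<n → ℕ.suc-injective (p≐q (s≤s i<j) (s≤s j<n)))
    refl refl (ℕ.≤-antisym (b≤ d p e q p≐q) (b≤ e q d p (λ i<j j<n → sym (p≐q i<j j<n))))
  where
  b≤ : ∀ {s t} d (p : Path (d + s) m) e (q : Path (e + t) m) →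
       colour (step d p) ≐[ suc (suc m) ] colour (step e q) → boundary p d ≤ boundary q e
  b≤ d p e q p≐q = ℕ.≮⇒≥ λ lt → contradiction
    (trans (sym (colour-far e q lt))
      (trans (sym (p≐q (s≤s z≤n) (s≤s (s≤s (boundary≤length d p))))) (colour-near d p ℕ.≤-refl)))
    λ ()

-- The edge gets colour `x` only if the nodes before `x` hand it on, so that node `x` is the root of
-- a tree.
colour-boundary⁻ : ∀ (p : Path s m) {x} → x < m → colour p 0 (suc x) ≡ x → ∃ λ q → q < s × boundary p q ≡ x
colour-boundary⁻ (step {s} d p) {x} x<m eq with x ≤? boundary p d
... | yes _ = 0 , s≤s z≤n , eq
colour-boundary⁻ (step d p) {zero}  _ eq | no x≰b = contradiction z≤n x≰b
colour-boundary⁻ (step {s} d p) {suc x} (s≤s x<m) eq | no x≰b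
  with q , q<d+s , b≡x ← colour-boundary⁻ p x<m (ℕ.suc-injective eq)
  -- The first `d` trees of the tail are subtrees of node 0 and merge into a single tree.
  = suc (q ∸ d) , s≤s q∸d<s , cong suc (trans (cong (boundary p) (ℕ.m+[n∸m]≡n d≤q)) b≡x)
  where
  d≤q : d ≤ q
  d≤q = boundary-cancel-≤ p (ℕ.m≤m+n d s)
    (subst (boundary p d ≤_) (sym b≡x) (s≤s⁻¹ (ℕ.≰⇒> x≰b)))
  q∸d<s : q ∸ d < s
  q∸d<s = ℕ.+-cancelˡ-< d _ _ (subst (_< d + s) (sym (ℕ.m+[n∸m]≡n d≤q)) q<d+s)

last-zero : (f : ℕ → ℕ) → f 0 ≡ 0 → ∀ m →
            ∃ λ b → b ≤ m × f b ≡ 0 × (∀ {j} → b < j → j ≤ m → f j ≢ 0)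
last-zero f f₀ zero = 0 , z≤n , f₀ , λ { (s≤s _) () }
last-zero f f₀ (suc m) with f (suc m) ℕ.≟ 0
... | yes eq = suc m , ℕ.≤-refl , eq , λ b<j j≤m → contradiction j≤m (ℕ.<⇒≱ b<j)
... | no neq with b , b≤m , eq , later ← last-zero f f₀ m =
  b , ℕ.m≤n⇒m≤1+n b≤m , eq , λ b<j j≤1+m → case b<j (ℕ.m≤n⇒m<n∨m≡n j≤1+m)
  where
  case : ∀ {j} → b < j → j < suc m ⊎ j ≡ suc m → f j ≢ 0
  case b<j (inj₁ j<1+m) = later b<j (s≤s⁻¹ j<1+m)
  case b<j (inj₂ refl)  = neq

module _ {c : ℕ → ℕ → ℕ} (col : IsColouring (suc (suc m)) c) where
  open IsColouring col

  shift : ℕ → ℕ → ℕ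
  shift i j = pred (c (suc i) (suc j))

  -- By `range` these colours are positive, so the truncated `pred` loses nothing.
  suc-shift : ∀ {i j} → i < j → j < suc m → c (suc i) (suc j) ≡ suc (shift i j)
  suc-shift {i} {j} i<j j<n =
    sym (ℕ.suc-pred _ {{>-nonZero (ℕ.≤-trans (s≤s z≤n) (proj₁ (range (s≤s i<j) (s≤s j<n))))}})

  shift-colouring : IsColouring (suc m) shift
  shift-colouring = record
    { consecutive = λ lt → cong pred (consecutive (s≤s lt))
    ; triangle    = λ i<j j<k k<n →
        Sum.map (cong pred) (cong pred) (triangle (s≤s i<j) (s≤s j<k) (s≤s k<n)) }

  -- Let `(0, b+1)` be the longest edge of colour 0 at vertex 0. Shorter edges at 0 have colour 0 by
  -- triangles with it, and longer ones take the colour of the edge from 1 by triangles with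
  -- `(0, 1)`. Hence `b` is the only choice. If `b < m`, the triangle `(0, b+1, b+2)` forces colour
  -- `b+1` on its long side, so `colour-boundary⁻` makes `b` a boundary of `p`, and the trees before
  -- it become the subtrees of node 0.
  extend-path : (p : Path s m) → colour p ≐[ suc m ] shift →
                ∃₂ λ t (q : Path t (suc m)) → colour q ≐[ suc (suc m) ] c
  extend-path {s} p p≐ = build (proj₁ split) (proj₁ (proj₂ split)) (proj₂ (proj₂ split))
    where
    first = last-zero (c 0 ∘ suc) (consecutive (s≤s (s≤s z≤n))) m
    b = proj₁ first
    b≤m = proj₁ (proj₂ first)
    c-b = proj₁ (proj₂ (proj₂ first))
    c-later = proj₂ (proj₂ (proj₂ first))

    near : ∀ {j} → j ≤ b → c 0 (suc j) ≡ 0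
    near j≤b with ℕ.m≤n⇒m<n∨m≡n j≤b
    ... | inj₂ refl = c-b
    ... | inj₁ j<b with triangle (s≤s z≤n) (s≤s j<b) (s≤s (s≤s b≤m))
    ...   | inj₁ e = trans (sym e) c-b
    ...   | inj₂ e with () ← trans (trans (sym c-b) e) (suc-shift j<b (s≤s b≤m))

    far : ∀ {j} → b < j → j ≤ m → c 0 (suc j) ≡ suc (shift 0 j)
    far b<j j≤m with triangle (s≤s z≤n) (s≤s (ℕ.≤-<-trans z≤n b<j)) (s≤s (s≤s j≤m))
    ... | inj₁ e = contradiction (trans e (near z≤n)) (c-later b<j j≤m)
    ... | inj₂ e = trans e (suc-shift (ℕ.≤-<-trans z≤n b<j) (s≤s j≤m))

    split : ∃ λ d → d ≤ s × boundary p d ≡ b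
    split with ℕ.m≤n⇒m<n∨m≡n b≤m
    ... | inj₂ b≡m = s , ℕ.≤-refl , trans (boundary-last p) (sym b≡m)
    ... | inj₁ b<m with triangle (s≤s z≤n) (ℕ.n<1+n (suc b)) (s≤s (s≤s b<m))
    ...   | inj₁ e = contradiction (trans e c-b) (c-later (ℕ.n<1+n b) b<m)
    ...   | inj₂ e =
      let d , d<s , b≡ = colour-boundary⁻ p b<m (trans (p≐ (s≤s z≤n) (s≤s b<m))
            (ℕ.suc-injective (trans (sym (far (ℕ.n<1+n b) b<m)) (trans e (consecutive (s≤s (s≤s b<m)))))))
      in d , ℕ.<⇒≤ d<s , b≡

    build : ∀ d → d ≤ s → boundary p d ≡ b →
            ∃₂ λ t (q : Path t (suc m)) → colour q ≐[ suc (suc m) ] c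
    build d d≤s b≡ with u , refl ← ℕ.m≤n⇒∃[o]m+o≡n d≤s = suc u , step d p , agree
      where
      agree : colour (step d p) ≐[ suc (suc m) ] c
      agree {suc i} {suc j} (s≤s i<j) (s≤s j<n) =
        trans (cong suc (p≐ i<j j<n)) (sym (suc-shift i<j j<n))
      agree {zero} {suc j} _ (s≤s (s≤s j≤m)) with j ≤? boundary p d
      ... | yes j≤b = sym (near (subst (j ≤_) b≡ j≤b))
      ... | no  j≰b = let b<j = subst (_< j) b≡ (ℕ.≰⇒> j≰b) in
        trans (cong suc (p≐ (ℕ.≤-<-trans z≤n b<j) (s≤s j≤m))) (sym (far b<j j≤m))

colour-surjective : ∀ m {c} → IsColouring (suc m) c →
                    ∃₂ λ s (p : Path s m) → colour p ≐[ suc m ] c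
colour-surjective zero    _   = 0 , stop , λ { (s≤s _) (s≤s ()) }
colour-surjective (suc m) col =
  let _ , p , p≐ = colour-surjective m (shift-colouring col) in extend-path col p p≐

-- Transitive partitions

unique∧set⇒↭ : ∀ {A : Set} {xs ys : List A} → Unique xs → Unique ys →
               (∀ {x} → x ∈ xs → x ∈ ys) → (∀ {x} → x ∈ ys → x ∈ xs) → xs ↭ ys
unique∧set⇒↭ xs! ys! to from = ∼bag⇒↭ (unique∧set⇒bag xs! ys! (mk⇔ to from))

module _ {A : Set} {f : Fin n → A} where

  -- Choosing a preimage for each of the `n` distinct entries of `ys` gives an injection of `Fin n`,
  -- hence a surjection. So every `u` is the preimage chosen for the entry `f u`.
  covering-injective : {ys : List A} → Unique ys → length ys ≡ n →
                       (∀ {y} → y ∈ ys → ∃ λ u → y ≡ f u) → Injective _≡_ _≡_ f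
  covering-injective {ys} ys! refl covered {u} {v} fu≡fv =
    trans (sym (proj₂ (preimage u))) (trans (cong index same) (proj₂ (preimage v)))
    where
    index : Fin n → Fin n
    index k = proj₁ (covered (List.∈-lookup k))
    index≡ : ∀ k → List.lookup ys k ≡ f (index k)
    index≡ k = proj₂ (covered (List.∈-lookup k))
    preimage : ∀ u → ∃ λ k → index k ≡ u
    preimage = injective⇒surjective λ {k} {l} eq →
      lookup-injective ys! (trans (index≡ k) (trans (cong f eq) (sym (index≡ l))))
    same : proj₁ (preimage u) ≡ proj₁ (preimage v)
    same = lookup-injective ys! (trans (index≡ _) (trans (cong f (proj₂ (preimage u)))
      (trans fu≡fv (sym (trans (index≡ _) (cong f (proj₂ (preimage v))))))))

∈-toSubset : ∀ {P : Fin n → Set} (P? : ∀ i → Dec (P i)) {i} → i Subset.∈ toSubset P? ⇔ P i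
∈-toSubset P? {i} = mk⇔
  (λ i∈ → witness (P? i) (trans (sym (Vec.lookup∘tabulate (does ∘ P?) i)) (Vec.[]=⇒lookup i∈)))
  (λ Pi → Vec.lookup⇒[]= i _ (trans (Vec.lookup∘tabulate (does ∘ P?) i) (dec-true (P? i) Pi)))
  where
  witness : ∀ {A : Set} (A? : Dec A) → does A? ≡ Subset.inside → A
  witness (yes a) _ = a

lookup-ext : ∀ {A : Set} {xs ys : Vec A n} → lookup xs ≗ lookup ys → xs ≡ ys
lookup-ext {xs = xs} {ys} eq = trans (sym (Vec.tabulate∘lookup xs))
  (trans (Vec.tabulate-cong eq) (Vec.tabulate∘lookup ys))

∃-toℕ : ∀ {x} → x < n → ∃ λ (i : Fin n) → x ≡ toℕ i
∃-toℕ x<n = fromℕ< x<n , sym (Fin.toℕ-fromℕ< x<n)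

zip-distinct : ∀ {A : Set} {x y : A} {xs} → Unique (x ∷ xs) → y ∉ x ∷ xs →
               ∀ {u v} → (u , v) ∈ zip (x ∷ xs) (xs ∷ʳ y) → u ≢ v
zip-distinct {xs = []}     _         y∉ (here refl) eq = y∉ (here (sym eq))
zip-distinct {xs = z ∷ xs} (x∉ ∷ u!) y∉ (here refl) eq = All.lookup x∉ (here refl) eq
zip-distinct {xs = z ∷ xs} (x∉ ∷ u!) y∉ (there uv∈)    = zip-distinct u! (y∉ ∘ there) uv∈

steps-distinct : ∀ {A : Set} {vs : List A} → 2 ≤ length vs → Unique vs →
                 ∀ {u v} → (u , v) ∈ steps vs → u ≢ v
steps-distinct {vs = x ∷ y ∷ vs} _ (x∉ ∷ u!) (here refl) = All.lookup x∉ (here refl)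
steps-distinct {vs = x ∷ y ∷ vs} _ (x∉ ∷ u!) (there uv∈) =
  zip-distinct u! (λ x∈ → All.lookup x∉ x∈ refl) uv∈
steps-distinct {vs = x ∷ []} (s≤s ())

zip-chain : ∀ {A : Set} {R : A → A → Set} → (∀ {u v w} → R u v → R v w → R u w) →
            ∀ {x y xs} → (∀ {u v} → (u , v) ∈ zip (x ∷ xs) (xs ∷ʳ y) → R u v) → R x y
zip-chain R-trans {xs = []}     R-step = R-step (here refl)
zip-chain R-trans {xs = z ∷ xs} R-step =
  R-trans (R-step (here refl)) (zip-chain R-trans (R-step ∘ there))

-- Reversing the edges outside a set of colours.

module Tournament {c : ℕ → ℕ → ℕ} (col : IsColouring n c) (A : ℕ → Set) where
  open IsColouring col

  infix 4 _⟶_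
  data _⟶_ (u v : Fin n) : Set where
    up   : u Fin.< v → A (c (toℕ u) (toℕ v)) → u ⟶ v
    down : v Fin.< u → ¬ A (c (toℕ v) (toℕ u)) → u ⟶ v

  ⟶-irrefl : ∀ {u} → ¬ u ⟶ u
  ⟶-irrefl (up   u<u _) = ℕ.<-irrefl refl u<u
  ⟶-irrefl (down u<u _) = ℕ.<-irrefl refl u<u

  private
    tri : ∀ {i j k : Fin n} → i Fin.< j → j Fin.< k →
          c (toℕ i) (toℕ k) ≡ c (toℕ i) (toℕ j) ⊎ c (toℕ i) (toℕ k) ≡ c (toℕ j) (toℕ k)
    tri i<j j<k = triangle i<j j<k (Fin.toℕ<n _)

  -- A cyclic orientation of `i < j < k` would put the two short edges on one side of `A` and the
  -- long edge on the other, but the long edge shares its colour with a short one.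
  ⟶-trans : ∀ {u v w} → u ⟶ v → v ⟶ w → u ⟶ w
  ⟶-trans (up u<v a) (up v<w b) = up (ℕ.<-trans u<v v<w) (
    Sum.[ (λ e → subst A (sym e) a) , (λ e → subst A (sym e) b) ] (tri u<v v<w))
  ⟶-trans (down v<u a) (down w<v b) = down (ℕ.<-trans w<v v<u) (
    Sum.[ (λ e → b ∘ subst A e) , (λ e → a ∘ subst A e) ] (tri w<v v<u))
  ⟶-trans {u} {v} {w} (up u<v a) (down w<v b) with Fin.<-cmp u w
  ... | tri< u<w _ _ = up u<w (
    Sum.[ (λ e → subst A e a) , (λ e → contradiction (subst A e a) b) ] (tri u<w w<v))
  ... | tri≈ _ refl _ = contradiction a b
  ... | tri> _ _ w<u = down w<u (
    Sum.[ (λ e → b ∘ subst A (sym e)) , (λ e → contradiction (subst A (sym e) a) b) ] (tri w<u u<v))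
  ⟶-trans {u} {v} {w} (down v<u a) (up v<w b) with Fin.<-cmp u w
  ... | tri< u<w _ _ = up u<w (
    Sum.[ (λ e → contradiction (subst A e b) a) , (λ e → subst A e b) ] (tri v<u u<w))
  ... | tri≈ _ refl _ = contradiction b a
  ... | tri> _ _ w<u = down w<u (
    Sum.[ (λ e → contradiction (subst A (sym e) b) a) , (λ e → a ∘ subst A (sym e)) ] (tri v<w w<u))

suc<⇒<pred : ∀ {x} → suc x < n → x < n ∸ 1
suc<⇒<pred (s≤s x<n) = x<n

suc-toℕ<n : ∀ n (i : Fin (n ∸ 1)) → suc (toℕ i) < n
suc-toℕ<n (suc n) i = s≤s (Fin.toℕ<n i)

toℕ-left : ∀ n (i : Fin (n ∸ 1)) → toℕ (left {n} i) ≡ toℕ i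
toℕ-left (suc n) i = Fin.toℕ-inject₁ i

toℕ-right : ∀ n (i : Fin (n ∸ 1)) → toℕ (right {n} i) ≡ suc (toℕ i)
toℕ-right (suc n) i = refl

left<right : ∀ n (i : Fin (n ∸ 1)) → left {n} i Fin.< right {n} i
left<right n i = subst₂ _<_ (sym (toℕ-left n i)) (sym (toℕ-right n i)) (ℕ.n<1+n (toℕ i))

-- Blocks as colour classes.

module Edges (n : ℕ) where

  endpoints-< : ∀ (e : Edge n) → proj₁ (endpoints n e) Fin.< proj₂ (endpoints n e)
  endpoints-< e = proj₂ (∈-filter⁻ (λ (i , j) → i Fin.<? j)
    {xs = cartesianProduct (allFin n) (allFin n)} (List.∈-lookup {xs = edges n} e))

  endpoints-injective : ∀ {e f : Edge n} → endpoints n e ≡ endpoints n f → e ≡ f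
  endpoints-injective = lookup-injective (Unique.filter⁺ (λ (i , j) → i Fin.<? j)
    (Unique.cartesianProduct⁺ (Unique.allFin⁺ n) (Unique.allFin⁺ n)))

  ∈-edges : ∀ {i j : Fin n} → i Fin.< j → (i , j) ∈ edges n
  ∈-edges i<j = ∈-filter⁺ (λ (i , j) → i Fin.<? j) (∈-cartesianProduct⁺ (∈-allFin _) (∈-allFin _)) i<j

  edge : ∀ {i j : Fin n} → i Fin.< j → Edge n
  edge i<j = Any.index (∈-edges i<j)

  endpoints-edge : ∀ {i j : Fin n} (i<j : i Fin.< j) → endpoints n (edge i<j) ≡ (i , j)
  endpoints-edge i<j = sym (Any.lookup-index (∈-edges i<j))

  edge-endpoints : ∀ (e : Edge n) {i j} (i<j : i Fin.< j) → endpoints n e ≡ (i , j) → e ≡ edge i<j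
  edge-endpoints e i<j eq = endpoints-injective (trans eq (sym (endpoints-edge i<j)))

  edgeColour : (ℕ → ℕ → ℕ) → Edge n → ℕ
  edgeColour c e = c (toℕ (proj₁ (endpoints n e))) (toℕ (proj₂ (endpoints n e)))

  edgeColour-edge : ∀ c {i j : Fin n} (i<j : i Fin.< j) → edgeColour c (edge i<j) ≡ c (toℕ i) (toℕ j)
  edgeColour-edge c i<j = cong (λ (i , j) → c (toℕ i) (toℕ j)) (endpoints-edge i<j)

  record Represents (p : BlockMap n) (c : ℕ → ℕ → ℕ) : Set where
    field
      ∈⇔ : ∀ e f → f Subset.∈ lookup p e ⇔ edgeColour c f ≡ edgeColour c e

  open Represents

  blockMap : (ℕ → ℕ → ℕ) → BlockMap n
  blockMap c = tabulate λ e → toSubset λ f → edgeColour c f ℕ.≟ edgeColour c e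

  blockMap-represents : ∀ c → Represents (blockMap c) c
  blockMap-represents c .∈⇔ e f = subst (λ b → f Subset.∈ b ⇔ edgeColour c f ≡ edgeColour c e)
    (sym (Vec.lookup∘tabulate {n = #edges n} _ e)) (∈-toSubset λ f → edgeColour c f ℕ.≟ edgeColour c e)

  module _ {p : BlockMap n} {c : ℕ → ℕ → ℕ} (repr : Represents p c) where

    same-block : ∀ {e f} → edgeColour c e ≡ edgeColour c f → lookup p e ≡ lookup p f
    same-block {e} {f} eq = Subset.⊆-antisym
      (λ {x} x∈ → Equivalence.from (∈⇔ repr f x) (trans (Equivalence.to (∈⇔ repr e x) x∈) eq))
      (λ {x} x∈ → Equivalence.from (∈⇔ repr e x) (trans (Equivalence.to (∈⇔ repr f x) x∈) (sym eq)))

    same-block⁻ : ∀ {e f} → lookup p e ≡ lookup p f → edgeColour c e ≡ edgeColour c f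
    same-block⁻ {e} {f} eq = Equivalence.to (∈⇔ repr f e)
      (subst (e Subset.∈_) eq (Equivalence.from (∈⇔ repr e e) refl))

  represents-unique : ∀ {p q : BlockMap n} {c d} → (∀ (e : Edge n) → edgeColour c e ≡ edgeColour d e) →
                      Represents p c → Represents q d → p ≡ q
  represents-unique {c = c} {d} c≗d p-repr q-repr = lookup-ext λ e → Subset.⊆-antisym
    (λ {f} f∈ → Equivalence.from (∈⇔ q-repr e f)
      (trans (sym (c≗d f)) (trans (Equivalence.to (∈⇔ p-repr e f) f∈) (c≗d e))))
    (λ {f} f∈ → Equivalence.from (∈⇔ p-repr e f)
      (trans (c≗d f) (trans (Equivalence.to (∈⇔ q-repr e f) f∈) (sym (c≗d e)))))

  ≐⇒edgeColour : ∀ {c d} → c ≐[ n ] d → ∀ (e : Edge n) → edgeColour c e ≡ edgeColour d e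
  ≐⇒edgeColour c≐d e = c≐d (endpoints-< e) (Fin.toℕ<n _)

  ∈-blocks⁺ : ∀ (p : BlockMap n) e → lookup p e ∈ blocks n p
  ∈-blocks⁺ p e = ∈-deduplicate⁺ _≟ˢ_ (Vec.∈-toList⁺ (Vec.∈-lookup e p))

  ∈-blocks⁻ : ∀ (p : BlockMap n) {b} → b ∈ blocks n p → ∃ λ e → b ≡ lookup p e
  ∈-blocks⁻ p b∈ = let b∈p = Vec.∈-toList⁻ (∈-deduplicate⁻ _≟ˢ_ (toList p) b∈) in
    VecAny.index b∈p , VecAny.lookup-index b∈p

  edgeFunction : (Edge n → ℕ) → ℕ → ℕ → ℕ
  edgeFunction h i j with i ℕ.<? j | j ℕ.<? n
  ... | yes i<j | yes j<n = h (edge {i = fromℕ< (ℕ.<-trans i<j j<n)} {fromℕ< j<n}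
                                (subst₂ _<_ (sym (Fin.toℕ-fromℕ< _)) (sym (Fin.toℕ-fromℕ< _)) i<j))
  -- A default outside `i < j < n`, a region about which `IsColouring` and `_≐[_]_` say nothing.
  ... | _       | _       = 0

  edgeColour-edgeFunction : ∀ (h : Edge n → ℕ) e → edgeColour (edgeFunction h) e ≡ h e
  edgeColour-edgeFunction h e with i , j ← endpoints n e in ij≡ | i<j ← endpoints-< e
    with toℕ i ℕ.<? toℕ j | toℕ j ℕ.<? n
  ... | yes i<j | yes j<n = cong h (sym (edge-endpoints e _
          (trans ij≡ (cong₂ _,_ (sym (Fin.fromℕ<-toℕ i _)) (sym (Fin.fromℕ<-toℕ j _))))))
  ... | no  i≮j | _       = contradiction i<j i≮j
  ... | yes _   | no j≮n  = contradiction (Fin.toℕ<n j) j≮n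

  unit : Fin (n ∸ 1) → Edge n
  unit i = edge (left<right n i)

  endpoints-unit : ∀ i → endpoints n (unit i) ≡ (left i , right i)
  endpoints-unit i = endpoints-edge (left<right n i)

  edgeColour-unit : ∀ {c} → IsColouring n c → ∀ i → edgeColour c (unit i) ≡ toℕ i
  edgeColour-unit {c} col i = trans (edgeColour-edge c (left<right n i))
    (trans (cong₂ c (toℕ-left n i) (toℕ-right n i)) (IsColouring.consecutive col (suc-toℕ<n n i)))

  module _ {c : ℕ → ℕ → ℕ} (col : IsColouring n c) where
    open IsColouring col

    unitOfColour : (e : Edge n) → ∃ λ i → edgeColour c e ≡ edgeColour c (unit i)
    unitOfColour e with lo , hi ← range (endpoints-< e) (Fin.toℕ<n _)
      with i , eq ← ∃-toℕ (suc<⇒<pred (ℕ.≤-<-trans hi (Fin.toℕ<n _))) = i , trans eq (sym (edgeColour-unit col i))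

  -- Each colour is named after the edge `(i, i+1)` in its class, so the partition determines the
  -- colouring.
  represents-edgeColour : ∀ {p : BlockMap n} {c d} → IsColouring n c → IsColouring n d →
                          Represents p c → Represents p d → ∀ e → edgeColour c e ≡ edgeColour d e
  represents-edgeColour c-col d-col c-repr d-repr e = let u , eq = unitOfColour c-col e in
    trans eq (trans (edgeColour-unit c-col u) (trans (sym (edgeColour-unit d-col u))
      (Equivalence.to (∈⇔ d-repr e (unit u)) (Equivalence.from (∈⇔ c-repr e (unit u)) (sym eq)))))

  represents-≐ : ∀ {p : BlockMap n} {c d} → IsColouring n c → IsColouring n d →
                 Represents p c → Represents p d → c ≐[ n ] d
  represents-≐ {p} {c} {d} c-col d-col c-repr d-repr x<y y<n
    with i , refl ← ∃-toℕ (ℕ.<-trans x<y y<n) | j , refl ← ∃-toℕ y<n =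
    trans (sym (edgeColour-edge c x<y))
      (trans (represents-edgeColour {p} c-col d-col c-repr d-repr (edge x<y)) (edgeColour-edge d x<y))

  module _ {p : BlockMap n} {c : ℕ → ℕ → ℕ}
           (col : IsColouring n c) (repr : Represents p c) where

    singletonBlock⇔ : ∀ i → SingletonAt n p i ⇔ (∀ f → edgeColour c f ≡ toℕ i → f ≡ unit i)
    singletonBlock⇔ i = mk⇔ to from
      where
      own : ∀ e g → ⁅ e ⁆ ≡ lookup p g → ∀ f → edgeColour c f ≡ edgeColour c e → f ≡ e
      own e g ⁅e⁆≡ f eq = Subset.x∈⁅y⁆⇒x≡y e (subst (f Subset.∈_) (sym ⁅e⁆≡)
        (Equivalence.from (∈⇔ repr g f) (trans eq (Equivalence.to (∈⇔ repr g e)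
          (subst (e Subset.∈_) ⁅e⁆≡ (Subset.x∈⁅x⁆ e))))))
      to : SingletonAt n p i → ∀ f → edgeColour c f ≡ toℕ i → f ≡ unit i
      to (e , e≡ , ⁅e⁆∈) f f-col = trans (own e _ (proj₂ (∈-blocks⁻ p ⁅e⁆∈)) f
        (trans f-col (sym (trans (cong (edgeColour c) e≡unit) (edgeColour-unit col i))))) e≡unit
        where
        e≡unit : e ≡ unit i
        e≡unit = edge-endpoints e (left<right n i) e≡
      from : (∀ f → edgeColour c f ≡ toℕ i → f ≡ unit i) → SingletonAt n p i
      from only = unit i , endpoints-unit i ,
        subst (_∈ blocks n p) (Subset.⊆-antisym ⊆⁅⁆ ⁅⁆⊆) (∈-blocks⁺ p (unit i))
        where
        ⁅⁆⊆ : ⁅ unit i ⁆ Subset.⊆ lookup p (unit i)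
        ⁅⁆⊆ {f} f∈ = subst (Subset._∈ lookup p (unit i)) (sym (Subset.x∈⁅y⁆⇒x≡y (unit i) f∈))
          (Equivalence.from (∈⇔ repr (unit i) (unit i)) refl)
        ⊆⁅⁆ : lookup p (unit i) Subset.⊆ ⁅ unit i ⁆
        ⊆⁅⁆ {f} f∈ = subst (Subset._∈ ⁅ unit i ⁆)
          (sym (only f (trans (Equivalence.to (∈⇔ repr (unit i) f) f∈) (edgeColour-unit col i))))
          (Subset.x∈⁅x⁆ (unit i))

  only-unit⇔ : ∀ c i → (∀ f → edgeColour c f ≡ toℕ i → f ≡ unit i) ⇔ IsSingleton n c (toℕ i)
  only-unit⇔ c i = mk⇔ to from
    where
    to : (∀ f → edgeColour c f ≡ toℕ i → f ≡ unit i) → IsSingleton n c (toℕ i)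
    to only x y x<y y<n eq = to′ (∃-toℕ (ℕ.<-trans x<y y<n)) (∃-toℕ y<n) x<y eq
      where
      to′ : (∃ λ (u : Fin n) → x ≡ toℕ u) → (∃ λ (v : Fin n) → y ≡ toℕ v) →
            x < y → c x y ≡ toℕ i → x ≡ toℕ i × y ≡ suc (toℕ i)
      to′ (u , refl) (v , refl) u<v eq =
        trans (cong toℕ (proj₁ uv≡)) (toℕ-left n i) , trans (cong toℕ (proj₂ uv≡)) (toℕ-right n i)
        where
        uv≡ : u ≡ left i × v ≡ right i
        uv≡ = ,-injective (trans (sym (endpoints-edge u<v)) (trans
          (cong (endpoints n) (only (edge u<v) (trans (edgeColour-edge c u<v) eq))) (endpoints-unit i)))
    from : IsSingleton n c (toℕ i) → ∀ f → edgeColour c f ≡ toℕ i → f ≡ unit i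
    from single f eq = edge-endpoints f (left<right n i) (cong₂ _,_
      (Fin.toℕ-injective (trans (proj₁ xy≡) (sym (toℕ-left n i))))
      (Fin.toℕ-injective (trans (proj₂ xy≡) (sym (toℕ-right n i)))))
      where
      xy≡ = single _ _ (endpoints-< f) (Fin.toℕ<n _) eq

  module _ {p : BlockMap n} {c : ℕ → ℕ → ℕ}
           (col : IsColouring n c) (repr : Represents p c) where

    represents⇒partition : IsPartition n p
    represents⇒partition =
      (λ e → Equivalence.from (∈⇔ repr e e) refl) ,
      (λ e f f∈ → same-block {p} repr (Equivalence.to (∈⇔ repr e f) f∈))

    -- The edges `unit i` form a system of representatives of the blocks.
    represents⇒#blocks : length (blocks n p) ≡ n ∸ 1
    represents⇒#blocks = trans
      (↭-length (unique∧set⇒↭ (DecUnique.deduplicate-! _≟ˢ_ (toList p))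
        (Unique.map⁺ units-injective (Unique.allFin⁺ (n ∸ 1))) to from))
      (trans (length-map _ (allFin (n ∸ 1))) (length-tabulate {n = n ∸ 1} _))
      where
      block : Fin (n ∸ 1) → Subset (#edges n)
      block i = lookup p (unit i)
      units-injective : ∀ {i j} → block i ≡ block j → i ≡ j
      units-injective {i} {j} eq = Fin.toℕ-injective (trans (sym (edgeColour-unit col i))
        (trans (same-block⁻ {p} repr eq) (edgeColour-unit col j)))
      to : ∀ {b} → b ∈ blocks n p → b ∈ map block (allFin (n ∸ 1))
      to b∈ = let e , b≡ = ∈-blocks⁻ p b∈; i , eq = unitOfColour col e in
        subst (_∈ map block (allFin (n ∸ 1))) (trans (sym (same-block {p} repr eq)) (sym b≡))
          (∈-map⁺ block (∈-allFin i))
      from : ∀ {b} → b ∈ map block (allFin (n ∸ 1)) → b ∈ blocks n p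
      from b∈ with i , _ , refl ← ∈-map⁻ block b∈ = ∈-blocks⁺ p (unit i)

    -- A cycle without an opposite pair is a directed cycle once the edges whose
    -- colour is not used along it are reversed; but that tournament is transitive.
    represents⇒transitive : IsTransitive n p
    represents⇒transitive []           (()        , _)
    represents⇒transitive vs@(v ∷ vs′) (3≤ , u!) =
      decidable-stable (hasOppositePair? n p vs) λ no-pair →
        ⟶-irrefl (zip-chain ⟶-trans {v} {v} {vs′} (directed no-pair))
      where
      Used : ℕ → Set
      Used x = ∃ λ e → Along n e vs × edgeColour c e ≡ x
      open Tournament col Used
      directed : ¬ HasOppositePair n p vs → ∀ {u w} → (u , w) ∈ steps vs → u ⟶ w
      directed no-pair {u} {w} uw∈ with Fin.<-cmp u w
      ... | tri< u<w _ _ = up u<w (edge u<w ,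
        subst (_∈ steps vs) (sym (endpoints-edge u<w)) uw∈ , edgeColour-edge c u<w)
      ... | tri≈ _ u≡w _ = contradiction u≡w (steps-distinct (ℕ.<⇒≤ 3≤) u! uw∈)
      ... | tri> _ _ w<u = down w<u λ (e , e∈ , eq) → no-pair (e , edge w<u ,
        Equivalence.from (∈⇔ repr e (edge w<u)) (trans (edgeColour-edge c w<u) (sym eq)) , e∈ ,
        subst (λ (i , j) → (j , i) ∈ steps vs) (sym (endpoints-edge w<u)) uw∈)

    represents⇒InT : InT n (n ∸ 1) p
    represents⇒InT = represents⇒partition , represents⇒#blocks , represents⇒transitive

  -- From transitive partitions to colourings.

  module _ {p : BlockMap n} (p∈T : InT n (n ∸ 1) p) where

    private
      partition = proj₁ p∈T
      #blocks≡  = proj₁ (proj₂ p∈T)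
      trans-p   = proj₂ (proj₂ p∈T)

    -- In the cycle `i, j, k` only `(i, k)` is traversed backwards, so it belongs to the opposite
    -- pair.
    triangle-block : ∀ {i j k : Fin n} (i<j : i Fin.< j) (j<k : j Fin.< k) →
                     let b = λ {x y} (lt : x Fin.< y) → lookup p (edge lt); i<k = ℕ.<-trans i<j j<k in
                     b i<k ≡ b i<j ⊎ b i<k ≡ b j<k
    triangle-block {i} {j} {k} i<j j<k
      with e , f , f∈ , e-along , f-against ← trans-p (i ∷ j ∷ k ∷ []) (s≤s (s≤s (s≤s z≤n)) ,
             (Fin.<⇒≢ i<j ∷ Fin.<⇒≢ (ℕ.<-trans i<j j<k) ∷ []) ∷ (Fin.<⇒≢ j<k ∷ []) ∷ [] ∷ [])
      = Sum.map (conclude f-against) (conclude f-against) (along e-along)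
      where
      i<k = ℕ.<-trans i<j j<k
      along : ∀ {e} → Along n e (i ∷ j ∷ k ∷ []) → e ≡ edge i<j ⊎ e ≡ edge j<k
      along {e} (here eq)         = inj₁ (edge-endpoints e i<j eq)
      along {e} (there (here eq)) = inj₂ (edge-endpoints e j<k eq)
      along {e} (there (there (here eq))) =
        contradiction (subst (λ (x , y) → x Fin.< y) eq (endpoints-< e)) (ℕ.<-asym i<k)
      against : ∀ {f} → Against n f (i ∷ j ∷ k ∷ []) → f ≡ edge i<k
      against {f} (here eq) =
        contradiction (subst (λ (x , y) → y Fin.< x) eq (endpoints-< f)) (ℕ.<-asym i<j)
      against {f} (there (here eq)) =
        contradiction (subst (λ (x , y) → y Fin.< x) eq (endpoints-< f)) (ℕ.<-asym j<k)
      against {f} (there (there (here eq))) = edge-endpoints f i<k (cong swap eq)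
      conclude : Against n f (i ∷ j ∷ k ∷ []) → ∀ {g} → e ≡ g → lookup p (edge i<k) ≡ lookup p g
      conclude f-ag refl = trans (cong (lookup p) (sym (against f-ag))) (proj₂ partition e f f∈)

    -- Induction on the right end, carried as the number `y`: the triangle with `(j-1, j)` puts the
    -- edge into the block of that unit edge or of an edge with a smaller right end.
    ∃-unit-block : ∀ y {i j : Fin n} → toℕ j ≡ y → (i<j : i Fin.< j) →
                   ∃ λ u → lookup p (edge i<j) ≡ lookup p (unit u)
    ∃-unit-block zero    j≡ i<j with () ← subst (_ <_) j≡ i<j
    ∃-unit-block (suc y) {i} {j} j≡ i<j
      with u , y≡u ← ∃-toℕ (suc<⇒<pred (subst (_< n) j≡ (Fin.toℕ<n j))) =
      extend (ℕ.m≤n⇒m<n∨m≡n (s≤s⁻¹ (subst (toℕ i <_) j≡ i<j)))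
      where
      j≡right : j ≡ right u
      j≡right = Fin.toℕ-injective (trans j≡ (trans (cong suc y≡u) (sym (toℕ-right n u))))
      left≡ : toℕ (left u) ≡ y
      left≡ = trans (toℕ-left n u) (sym y≡u)
      left<j : left u Fin.< j
      left<j = subst (left u Fin.<_) (sym j≡right) (left<right n u)
      left-unit : edge left<j ≡ unit u
      left-unit = edge-endpoints _ (left<right n u) (trans (endpoints-edge left<j) (cong (left u ,_) j≡right))
      extend : toℕ i < y ⊎ toℕ i ≡ y → ∃ λ u → lookup p (edge i<j) ≡ lookup p (unit u)
      extend (inj₂ i≡y) = u , cong (lookup p) (edge-endpoints _ (left<right n u) (trans (endpoints-edge i<j)
        (cong₂ _,_ (Fin.toℕ-injective (trans i≡y (sym left≡))) j≡right)))
      extend (inj₁ i<y) = Sum.[ (λ eq → let v , eq′ = ∃-unit-block y left≡ i<left in v , trans (to eq) eq′)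
                              , (λ eq → u , trans (to eq) (cong (lookup p) left-unit)) ]
                          (triangle-block i<left left<j)
        where
        i<left : i Fin.< left u
        i<left = subst (toℕ i <_) (sym left≡) i<y
        -- `edge` takes a proof of `i < j`; edges built from different proofs are identified through
        -- their endpoints.
        to : ∀ {b} → lookup p (edge (ℕ.<-trans i<left left<j)) ≡ b → lookup p (edge i<j) ≡ b
        to = trans (cong (lookup p) (edge-endpoints (edge i<j) _ (endpoints-edge i<j)))

    unitOfBlock : ∀ e → ∃ λ u → lookup p e ≡ lookup p (unit u)
    unitOfBlock e = let u , eq = ∃-unit-block _ refl (endpoints-< e) in
      u , trans (cong (lookup p) (edge-endpoints e (endpoints-< e) refl)) eq

    -- The block count enters here: each of the `n ∸ 1` blocks contains one of the `n ∸ 1` unit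
    -- edges, so no two of these share a block.
    unit-block-injective : ∀ {u v} → lookup p (unit u) ≡ lookup p (unit v) → u ≡ v
    unit-block-injective = covering-injective (DecUnique.deduplicate-! _≟ˢ_ (toList p)) #blocks≡
      λ b∈ → let e , b≡ = ∈-blocks⁻ p b∈; u , eq = unitOfBlock e in u , trans b≡ eq

    private
      h : Edge n → ℕ
      h e = toℕ (proj₁ (unitOfBlock e))

      h-cong : ∀ {e f} → lookup p e ≡ lookup p f → h e ≡ h f
      h-cong {e} {f} eq = cong toℕ (unit-block-injective
        (trans (sym (proj₂ (unitOfBlock e))) (trans eq (proj₂ (unitOfBlock f)))))

      h-cong⁻ : ∀ {e f} → h e ≡ h f → lookup p e ≡ lookup p f
      h-cong⁻ {e} {f} eq = trans (proj₂ (unitOfBlock e))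
        (trans (cong (lookup p ∘ unit) (Fin.toℕ-injective eq)) (sym (proj₂ (unitOfBlock f))))

      c : ℕ → ℕ → ℕ
      c = edgeFunction h

      c-edge : ∀ {i j : Fin n} (i<j : i Fin.< j) → c (toℕ i) (toℕ j) ≡ h (edge i<j)
      c-edge i<j = trans (sym (edgeColour-edge c i<j)) (edgeColour-edgeFunction h (edge i<j))

    InT⇒represents : ∃ λ c → IsColouring n c × Represents p c
    InT⇒represents = c , record { consecutive = consecutive ; triangle = triangle } , repr
      where
      consecutive : ∀ {x} → suc x < n → c x (suc x) ≡ x
      consecutive x+1<n with i , refl ← ∃-toℕ (suc<⇒<pred x+1<n) =
        trans (cong₂ c (sym (toℕ-left n i)) (sym (toℕ-right n i)))
          (trans (c-edge (left<right n i)) (cong toℕ (unit-block-injective (sym (proj₂ (unitOfBlock (unit i)))))))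
      triangle : ∀ {x y z} → x < y → y < z → z < n → c x z ≡ c x y ⊎ c x z ≡ c y z
      triangle x<y y<z z<n
        with i , refl ← ∃-toℕ (ℕ.<-trans x<y (ℕ.<-trans y<z z<n))
           | j , refl ← ∃-toℕ (ℕ.<-trans y<z z<n) | k , refl ← ∃-toℕ z<n =
        Sum.map (λ eq → trans ik (trans (h-cong eq) (sym (c-edge x<y))))
                (λ eq → trans ik (trans (h-cong eq) (sym (c-edge y<z))))
                (triangle-block x<y y<z)
        where ik = c-edge (ℕ.<-trans x<y y<z)
      repr : Represents p c
      repr .∈⇔ e f = mk⇔
        (λ f∈ → trans (edgeColour-edgeFunction h f)
          (trans (h-cong (proj₂ partition e f f∈)) (sym (edgeColour-edgeFunction h e))))
        (λ eq → subst (f Subset.∈_) (h-cong⁻ (trans (sym (edgeColour-edgeFunction h f))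
          (trans eq (edgeColour-edgeFunction h e)))) (proj₁ partition f))

-- The bijections and the descent sets

toSubset-cong : ∀ {P Q : Fin n → Set} (P? : ∀ i → Dec (P i)) (Q? : ∀ i → Dec (Q i)) →
                (∀ i → P i ⇔ Q i) → toSubset P? ≡ toSubset Q?
toSubset-cong P? Q? P⇔Q = Vec.tabulate-cong λ i → does-⇔ (P⇔Q i) (P? i) (Q? i)

permWord : Path s m → Word m
permWord p = tabulate (perm p)

lookup-permWord : (p : Path s m) → lookup (permWord p) ≗ perm p
lookup-permWord p = Vec.lookup∘tabulate (perm p)

-- Indecomposability in terms of closed prefixes.

module _ {f : Fin n → Fin n} {k l : ℕ} (k≤n : k ≤ n)
         (bounded : ∀ i → toℕ i < k → toℕ (f i) < l) where

  restrict : Fin k → Fin l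
  restrict i = Fin.fromℕ< (bounded (Fin.inject≤ i k≤n)
    (subst (_< k) (sym (Fin.toℕ-inject≤ i k≤n)) (Fin.toℕ<n i)))

  toℕ-restrict : ∀ i → toℕ (restrict i) ≡ toℕ (f (Fin.inject≤ i k≤n))
  toℕ-restrict i = Fin.toℕ-fromℕ< _

  restrict-injective : Injective _≡_ _≡_ f → Injective _≡_ _≡_ restrict
  restrict-injective inj {i} {j} eq = Fin.inject≤-injective k≤n k≤n i j (inj (Fin.toℕ-injective
    (trans (sym (toℕ-restrict i)) (trans (cong toℕ eq) (toℕ-restrict j)))))

module _ {f : Fin n → Fin n} (inj : Injective _≡_ _≡_ f) {r : Fin n} where

  private
    Splits Closed : Set
    Splits = ∀ i j → i Fin.≤ r → r Fin.< j → f i Fin.< f j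
    Closed = ∀ i → toℕ i < suc (toℕ r) → toℕ (f i) < suc (toℕ r)

  -- Every value up to `f i` has its position at or before `r`, since `Splits` would otherwise place
  -- it above `f i`. So the inverse of `f` injects `toℕ (f i) + 1` values into `toℕ r + 1`
  -- positions.
  splits⇒closed : Splits → Closed
  splits⇒closed splits i i≤r = Fin.injective⇒≤
    (restrict-injective (Fin.toℕ<n (f i)) (λ v v≤fi → s≤s (ℕ.≮⇒≥ λ r<f⁻¹v →
      ℕ.<⇒≱ (splits i (f⁻¹ v) (s≤s⁻¹ i≤r) r<f⁻¹v)
        (subst (λ w → w Fin.≤ f i) (sym (f-f⁻¹ v)) (s≤s⁻¹ v≤fi))))
      (λ {v} {w} eq → trans (sym (f-f⁻¹ v)) (trans (cong f eq) (f-f⁻¹ w))))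
    where
    f⁻¹ : Fin n → Fin n
    f⁻¹ v = proj₁ (injective⇒surjective inj v)
    f-f⁻¹ : ∀ v → f (f⁻¹ v) ≡ v
    f-f⁻¹ v = proj₂ (injective⇒surjective inj v)

  -- On the closed prefix `f` restricts to an injection, hence a surjection, so a later position
  -- cannot take a value up to `r`.
  closed⇒splits : Closed → Splits
  closed⇒splits closed i j i≤r r<j = ℕ.<-≤-trans (closed i (s≤s i≤r)) (ℕ.≮⇒≥ λ fj≤r →
    let g = restrict (Fin.toℕ<n r) closed
        k , gk≡ = injective⇒surjective {f = g} (restrict-injective (Fin.toℕ<n r) closed inj) (Fin.fromℕ< fj≤r)
        k≡j : Fin.inject≤ k (Fin.toℕ<n r) ≡ j
        k≡j = inj (Fin.toℕ-injective (trans (sym (toℕ-restrict (Fin.toℕ<n r) closed k))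
                (trans (cong toℕ gk≡) (Fin.toℕ-fromℕ< fj≤r))))
    in ℕ.<⇒≱ r<j (subst (_≤ toℕ r)
         (trans (sym (Fin.toℕ-inject≤ k (Fin.toℕ<n r))) (cong toℕ k≡j)) (s≤s⁻¹ (Fin.toℕ<n k))))

-- State 1 is the initial one: `increasing` only says that the top of an inversion is nonzero, and
-- `connected` ranges over the nonempty proper prefixes.
good⇔InS*321 : (π : Word (suc m)) → Good 1 (lookup π) ⇔ InS*321 (suc m) π
good⇔InS*321 {m} π = mk⇔ to from
  where
  ClosedAt : ℕ → Set
  ClosedAt r = ∀ i → toℕ i < suc r → toℕ (lookup π i) < suc r
  to : Good 1 (lookup π) → InS*321 (suc m) π
  to good =
    ((λ {i j} → Good.injective good {i} {j}) ,
     strictlySurjective⇒surjective (injective⇒surjective (Good.injective good))) ,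
    (λ (r , splits) → Good.connected good (s≤s z≤n) (s≤s (Fin.toℕ<n r))
      (subst ClosedAt (Fin.toℕ-inject₁ r) (splits⇒closed (Good.injective good) splits))) ,
    (λ (_ , _ , _ , i<j , j<k , p , q) → Good.avoids good i<j j<k p q)
  not-closed : Injective _≡_ _≡_ (lookup π) → Indecomposable π →
              ∀ {r} → 1 ≤ r → r < suc m → ¬ (∀ i → toℕ i < r → toℕ (lookup π i) < r)
  not-closed inj indec {suc r} _ (s≤s r<m) closed with i , refl ← ∃-toℕ r<m =
    indec (i , closed⇒splits inj
      (subst ClosedAt (sym (Fin.toℕ-inject₁ i)) closed))
  from : InS*321 (suc m) π → Good 1 (lookup π)
  from ((inj , _) , indecomposable , avoids) = record
    { fits       = s≤s z≤n
    ; injective  = inj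
    ; avoids     = λ i<j j<k p q → avoids (_ , _ , _ , i<j , j<k , p , q)
    ; increasing = λ _ p → ℕ.≤-trans (s≤s z≤n) p
    ; connected  = not-closed inj indecomposable
    }

permWord-injective : {p q : Path s m} → permWord p ≡ permWord q → p ≡ q
permWord-injective {p = p} {q} eq = perm-injective λ i →
  trans (sym (lookup-permWord p i)) (trans (cong (λ w → lookup w i) eq) (lookup-permWord q i))

permWord∈S*321 : (p : Path 1 (suc m)) → permWord p ∈ S*321 (suc m)
permWord∈S*321 p = ∈-filter⁺ (inS*321? _) (vecs-complete ∈-allFin (permWord p))
  (Equivalence.to (good⇔InS*321 (permWord p)) (Good-resp-≗ (sym ∘ lookup-permWord p) (perm-good p)))

S*321⊆permWord : ∀ {π} → π ∈ S*321 (suc m) → ∃ λ (p : Path 1 (suc m)) → permWord p ≡ π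
S*321⊆permWord {m} {π} π∈ =
  let _ , π∈S = ∈-filter⁻ (inS*321? (suc m)) {xs = vecs (allFin (suc m)) (suc m)} π∈
      p , p≗ = perm-surjective (lookup π) (Equivalence.from (good⇔InS*321 π) π∈S)
  in p , lookup-ext λ i → trans (lookup-permWord p i) (p≗ i)

-- The colouring lives on the forest below the root, whose `m` nodes match the `m` unit edges; the
-- degree of the root is the number of trees there.
partition : Path 1 (suc m) → BlockMap (suc m)
partition {m} (step d p) = Edges.blockMap (suc m) (colour p)

root : ∀ s → t ≡ s + 0 → Path t m → Path 1 (suc m)
root s refl p = step s p

partition-root : ∀ s (t≡ : t ≡ s + 0) (p : Path t m) →
                 partition (root s t≡ p) ≡ Edges.blockMap (suc m) (colour p)
partition-root s refl p = refl

module _ {m : ℕ} where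
  open Edges (suc m)

  partition-injective : {p q : Path 1 (suc m)} → partition p ≡ partition q → p ≡ q
  partition-injective {step d p} {step e q} eq = step-injective (colour-injective p q
    (represents-≐ {blockMap (colour p)} (colouring p) (colouring q) (blockMap-represents (colour p))
      (subst (λ b → Represents b (colour q)) (sym eq) (blockMap-represents (colour q)))))
    where
    step-injective : ∀ {d e} {p : Path (d + 0) m} {q : Path (e + 0) m} →
                     _≡_ {A = ∃ λ s → Path s m} (d + 0 , p) (e + 0 , q) → step d p ≡ step e q
    step-injective {d} {e} eq with refl ← ℕ.+-cancelʳ-≡ 0 d e (cong proj₁ eq) | refl ← eq = refl

  partition∈T : (p : Path 1 (suc m)) → partition p ∈ T (suc m) m
  partition∈T (step d p) = ∈-filter⁺ (inT? (suc m) m) (vecs-complete (vecs-complete sides) _)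
    (represents⇒InT (colouring p) (blockMap-represents (colour p)))
    where
    sides : ∀ b → b ∈ outside ∷ inside ∷ []
    sides outside = here refl
    sides inside  = there (here refl)

  T⊆partition : ∀ {b} → b ∈ T (suc m) m → ∃ λ (p : Path 1 (suc m)) → partition p ≡ b
  T⊆partition {b} b∈ =
    let _ , b∈T = ∈-filter⁻ (inT? (suc m) m) {xs = vecs (allSubsets _) (#edges (suc m))} b∈
        c , c-col , repr = InT⇒represents b∈T
        s , p , p≐c = colour-surjective m c-col
        s≡ = sym (ℕ.+-identityʳ s)
    in root s s≡ p , trans (partition-root s s≡ p)
         (represents-unique (≐⇒edgeColour p≐c) (blockMap-represents (colour p)) repr)

  Des-partition : (p : Path 1 (suc m)) → DesT (suc m) (partition p) ≡ DesS (permWord p)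
  Des-partition q@(step d p) = toSubset-cong (singletonAt? (suc m) (partition q))
    (λ i → lookup (permWord q) (right i) Fin.<? lookup (permWord q) (left i)) λ i →
      (descent i ⇔-∘ ⇔-sym (perm-descent q i)) ⇔-∘
      (singleton⇔peak d p (Fin.toℕ<n i) ⇔-∘
        (only-unit⇔ (colour p) i ⇔-∘ singletonBlock⇔ (colouring p) (blockMap-represents (colour p)) i))
    where
    descent : ∀ i → perm q (suc i) Fin.< perm q (inject₁ i) ⇔
                    lookup (permWord q) (suc i) Fin.< lookup (permWord q) (inject₁ i)
    descent i = mk⇔
      (subst₂ Fin._<_ (sym (lookup-permWord q (suc i))) (sym (lookup-permWord q (inject₁ i))))
      (subst₂ Fin._<_ (lookup-permWord q (suc i)) (lookup-permWord q (inject₁ i)))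

-- Transfer along the common parametrisation.

preimages : ∀ {A P : Set} {f : P → A} {as} → All (λ a → ∃ λ p → f p ≡ a) as → ∃ λ ps → map f ps ≡ as
preimages []                         = [] , refl
preimages {f = f} ((p , refl) ∷ pas) = let ps , eq = preimages pas in p ∷ ps , cong (f p ∷_) eq

module _ {A B C P : Set} {as : List A} {bs : List B} (as! : Unique as) (bs! : Unique bs)
         {f : P → A} {g : P → B}
         (f-injective : ∀ {p q} → f p ≡ f q → p ≡ q) (g-injective : ∀ {p q} → g p ≡ g q → p ≡ q)
         (f∈ : ∀ p → f p ∈ as) (g∈ : ∀ p → g p ∈ bs)
         (f-onto : ∀ {a} → a ∈ as → ∃ λ p → f p ≡ a) (g-onto : ∀ {b} → b ∈ bs → ∃ λ p → g p ≡ b)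
         where

  -- The parameters `ps` are read off from `as` through `f`; their images under `g` are then a
  -- rearrangement of `bs`.
  map-↭-map : (D : A → C) (E : B → C) → (∀ p → D (f p) ≡ E (g p)) → map D as ↭ map E bs
  map-↭-map D E D≗E with ps , refl ← preimages {f = f} (All.tabulate f-onto) = ↭-trans
    (↭-reflexive (trans (sym (map-∘ ps)) (trans (map-cong D≗E ps) (map-∘ ps))))
    (↭-map⁺ E (unique∧set⇒↭ (Unique.map⁺ g-injective (Unique.map⁻ as!)) bs! to from))
    where
    to : ∀ {b} → b ∈ map g ps → b ∈ bs
    to b∈ with p , _ , refl ← ∈-map⁻ g b∈ = g∈ p
    from : ∀ {b} → b ∈ bs → b ∈ map g ps
    from b∈ with p , refl ← g-onto b∈ with q , q∈ , eq ← ∈-map⁻ f (f∈ p)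
      with refl ← f-injective eq = ∈-map⁺ g q∈

-- Both forms of the theorem sum a function of the descent set alone, so this one rearrangement
-- yields both.
Des-↭ : ∀ m → map (DesT (suc m)) (T (suc m) m) ↭ map DesS (S*321 (suc m))
Des-↭ m = map-↭-map
  (Unique.filter⁺ (inT? (suc m) m) (vecs-unique (vecs-unique sides! _) _))
  (Unique.filter⁺ (inS*321? (suc m)) (vecs-unique (Unique.allFin⁺ (suc m)) (suc m)))
  partition-injective permWord-injective partition∈T permWord∈S*321
  T⊆partition S*321⊆permWord (DesT (suc m)) DesS Des-partition
  where
  sides! : Unique (outside ∷ inside ∷ [])
  sides! = ((λ ()) ∷ []) ∷ [] ∷ []

module _ {c ℓ} (R : CommutativeRing c ℓ) where
  open CommutativeRing R using (Carrier; _≈_; setoid; +-isCommutativeMonoid; isEquivalence)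

  ∑-↭ : ∀ {A B C : Set} {as : List A} {bs : List B} {D : A → C} {E : B → C} (h : C → Carrier) →
        map D as ↭ map E bs → ∑ R as (h ∘ D) ≈ ∑ R bs (h ∘ E)
  ∑-↭ {as = as} {bs} h D↭E = subst₂ (λ xs ys → foldr _ _ xs ≈ foldr _ _ ys)
    (sym (map-∘ as)) (sym (map-∘ bs))
    (foldr-commMonoid setoid +-isCommutativeMonoid (↭⇒↭ₛ′ isEquivalence (↭-map⁺ h D↭E)))

theorem4p16 : (c ℓ : Level) (n : ℕ) → 2 ≤ n →
    ((R : CommutativeRing c ℓ) (x : Fin (n ∸ 1) → CommutativeRing.Carrier R) →
    CommutativeRing._≈_ R
    (∑ R (T n (n ∸ 1)) (λ p → monomial R x (DesT n p)))
    (∑ R (S*321 n) (λ π → monomial R x (DesS π))))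
    × (Q n (T n (n ∸ 1)) (DesT n) ≋ Q n (S*321 n) DesS)
theorem4p16 c ℓ (suc m) _ =
  (λ R x → ∑-↭ R (monomial R x) (Des-↭ m)) ,
  λ α → trans (cong sum (map-∘ (T (suc m) m)))
    (trans (sum-↭ (↭-map⁺ (λ J → F (suc m) J α) (Des-↭ m))) (cong sum (sym (map-∘ (S*321 (suc m))))))
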